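{- Let $k$ be an indeterminate and define $$a(k)=10k^2-8k+8,\qquad b(k)=k(k^2-4k+20),\qquad c(k)=(k+2)(k^2-4).$$ Let $E$ be the elliptic curve over $\mathbb{Q}(k)$ given by $$y^2=\big(x+a(k)b(k)\big)\big(x+b(k)c(k)\big)\big(x+a(k)c(k)\big).$$ Then the Mordell–Weil rank of $E(\mathbb{Q}(k))$ is at least $2$. -}

module Defs where

open import Algebra.Apartness.Bundles using (HeytingField)
open import Algebra.Bundles using (CommutativeRing; RawGroup)
import Algebra.Definitions.RawMonoid as RawMonoidDefinitions
import Algebra.Properties.AbelianGroup as AbelianGroupProperties
import Algebra.Properties.Group as GroupProperties
import Algebra.Properties.Ring as RingProperties
import Algebra.Properties.Semiring.Mult as SemiringMult
import Algebra.Solver.Ring as RingSolver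
open import Algebra.Solver.Ring.AlmostCommutativeRing using (_-Raw-AlmostCommutative⟶_; fromCommutativeRing)
open import Data.Fin.Base using (Fin)
open import Data.Integer.Base as ℤ using (ℤ; +_; -[1+_]; +0; _⊖_)
import Data.Integer.Properties as ℤ
open import Data.List.Base using (List; []; _∷_; map)
open import Data.Maybe.Base using (Maybe; just; nothing)
open import Data.Nat.Base as ℕ using (ℕ; zero; suc)
open import Data.Product.Base using (∃-syntax; _,_; proj₁; proj₂)
open import Data.Rational.Base as ℚ using (ℚ; 0ℚ; 1ℚ)
import Data.Rational.Properties as ℚ
open import Data.Sum.Base using (_⊎_; inj₁; inj₂; [_,_]′)
open import Level using (Level; 0ℓ; _⊔_)
open import Relation.Binary.Bundles using (DecSetoid)
open import Relation.Binary.Definitions using (Decidable)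
import Relation.Binary.Properties.DecSetoid as DecSetoidProperties
import Relation.Binary.Reasoning.Setoid as SetoidReasoning
open import Relation.Binary.PropositionalEquality as ≡ using (_≡_; _≢_)
open import Relation.Nullary.Decidable using (yes; no; map′; _×-dec_; ¬?; from-no)
open import Relation.Nullary.Negation using (¬_; contradiction)

private
  variable
    κ ℓ : Level

-- The library's solver normalises over a coefficient ring with (weakly)
-- decidable equality; here ℤ, mapped into an arbitrary commutative ring.
module IntegerSolver (R : CommutativeRing κ ℓ) where
  open CommutativeRing R
  open RingProperties ring using (-0#≈0#; -‿distribˡ-*; -‿distribʳ-*; -‿involutive)
  open AbelianGroupProperties +-abelianGroup using (⁻¹-∙-comm)
  open SemiringMult semiring using (×-homo-+; ×1-homo-*) renaming (_×_ to _·_)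
  open SetoidReasoning setoid

  ⟦_⟧ᶻ : ℤ → Carrier
  ⟦ + n      ⟧ᶻ = n · 1#
  ⟦ -[1+ n ] ⟧ᶻ = - (suc n · 1#)

  private
    cancel : ∀ x u v → (x + u) + - (x + v) ≈ u + - v
    cancel x u v = begin
      (x + u) + - (x + v)      ≈⟨ +-cong (+-comm x u) (sym (⁻¹-∙-comm x v)) ⟩
      (u + x) + (- x + - v)    ≈⟨ +-assoc u x _ ⟩
      u + (x + (- x + - v))    ≈⟨ +-congˡ (sym (+-assoc x (- x) (- v))) ⟩
      u + ((x + - x) + - v)    ≈⟨ +-congˡ (trans (+-congʳ (-‿inverseʳ x)) (+-identityˡ _)) ⟩
      u + - v                  ∎

    ⊖-homo : ∀ m n → ⟦ m ⊖ n ⟧ᶻ ≈ m · 1# + - (n · 1#)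
    ⊖-homo m       zero    = sym (trans (+-congˡ -0#≈0#) (+-identityʳ _))
    ⊖-homo zero    (suc n) = sym (+-identityˡ _)
    ⊖-homo (suc m) (suc n) rewrite ℤ.[1+m]⊖[1+n]≡m⊖n m n =
      trans (⊖-homo m n) (sym (cancel 1# (m · 1#) (n · 1#)))

    +-homo : ∀ i j → ⟦ i ℤ.+ j ⟧ᶻ ≈ ⟦ i ⟧ᶻ + ⟦ j ⟧ᶻ
    +-homo (+ m)      (+ n)      = ×-homo-+ 1# m n
    +-homo (+ m)      (-[1+ n ]) = ⊖-homo m (suc n)
    +-homo (-[1+ m ]) (+ n)      = trans (⊖-homo n (suc m)) (+-comm _ _)
    +-homo (-[1+ m ]) (-[1+ n ]) = begin
      - (suc (suc (m ℕ.+ n)) · 1#)         ≈⟨ -‿cong (+-congˡ (×-homo-+ 1# (suc m) n)) ⟩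
      - (1# + (suc m · 1# + n · 1#))       ≈⟨ -‿cong (sym (+-assoc _ _ _)) ⟩
      - ((1# + suc m · 1#) + n · 1#)       ≈⟨ -‿cong (+-congʳ (+-comm _ _)) ⟩
      - ((suc m · 1# + 1#) + n · 1#)       ≈⟨ -‿cong (+-assoc _ _ _) ⟩
      - (suc m · 1# + suc n · 1#)          ≈⟨ sym (⁻¹-∙-comm _ _) ⟩
      - (suc m · 1#) + - (suc n · 1#)      ∎

    -‿homo : ∀ i → ⟦ ℤ.- i ⟧ᶻ ≈ - ⟦ i ⟧ᶻ
    -‿homo (+ zero)   = sym -0#≈0#
    -‿homo (+ suc n)  = refl
    -‿homo (-[1+ n ]) = sym (-‿involutive _)

    pos-homo : ∀ m j → ⟦ + m ℤ.* j ⟧ᶻ ≈ ⟦ + m ⟧ᶻ * ⟦ j ⟧ᶻ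
    pos-homo m (+ n) rewrite ≡.sym (ℤ.pos-* m n) = ×1-homo-* m n
    pos-homo m (-[1+ n ])
      rewrite ≡.sym (ℤ.neg-distribʳ-* (+ m) (+ suc n))
            | ≡.sym (ℤ.pos-* m (suc n)) = begin
      ⟦ ℤ.- (+ (m ℕ.* suc n)) ⟧ᶻ    ≈⟨ -‿homo (+ (m ℕ.* suc n)) ⟩
      - ((m ℕ.* suc n) · 1#)        ≈⟨ -‿cong (×1-homo-* m (suc n)) ⟩
      - (m · 1# * (suc n · 1#))     ≈⟨ -‿distribʳ-* _ _ ⟩
      m · 1# * - (suc n · 1#)       ∎

    *-homo : ∀ i j → ⟦ i ℤ.* j ⟧ᶻ ≈ ⟦ i ⟧ᶻ * ⟦ j ⟧ᶻ
    *-homo (+ m)      j = pos-homo m j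
    *-homo (-[1+ m ]) j rewrite ≡.sym (ℤ.neg-distribˡ-* (+ suc m) j) = begin
      ⟦ ℤ.- (+ suc m ℤ.* j) ⟧ᶻ    ≈⟨ -‿homo (+ suc m ℤ.* j) ⟩
      - ⟦ + suc m ℤ.* j ⟧ᶻ        ≈⟨ -‿cong (pos-homo (suc m) j) ⟩
      - (⟦ + suc m ⟧ᶻ * ⟦ j ⟧ᶻ)   ≈⟨ -‿distribˡ-* _ _ ⟩
      - ⟦ + suc m ⟧ᶻ * ⟦ j ⟧ᶻ     ∎

    morphism : ℤ.+-*-rawRing -Raw-AlmostCommutative⟶ fromCommutativeRing R
    morphism = record
      { ⟦_⟧    = ⟦_⟧ᶻ
      ; +-homo = +-homo
      ; *-homo = *-homo
      ; -‿homo = -‿homo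
      ; 0-homo = refl
      ; 1-homo = +-identityʳ 1#
      }

    weaklyDec : ∀ i j → Maybe (⟦ i ⟧ᶻ ≈ ⟦ j ⟧ᶻ)
    weaklyDec i j with i ℤ.≟ j
    ... | yes i≡j = just (reflexive (≡.cong ⟦_⟧ᶻ i≡j))
    ... | no  _   = nothing

  open RingSolver ℤ.+-*-rawRing (fromCommutativeRing R) morphism weaklyDec public
    using (solve; con; _:=_; _:+_; _:*_; _:-_; :-_)

module Polynomial where

  infix  8 -_
  infixr 7 _·_
  infixl 7 _*_
  infixl 6 _+_ _-_
  infix  4 _≈_ _≟_

  -- Coefficients in order of increasing degree; trailing zeros are allowed.
  ℚ[k] : Set
  ℚ[k] = List ℚ

  coeff : ℚ[k] → ℕ → ℚ
  coeff []      _       = 0ℚ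
  coeff (a ∷ p) zero    = a
  coeff (a ∷ p) (suc i) = coeff p i

  record _≈_ (p q : ℚ[k]) : Set where
    constructor coeffwise
    field at : ∀ i → coeff p i ≡ coeff q i
  open _≈_ public

  _+_ : ℚ[k] → ℚ[k] → ℚ[k]
  []      + q       = q
  (a ∷ p) + []      = a ∷ p
  (a ∷ p) + (b ∷ q) = a ℚ.+ b ∷ p + q

  -_ : ℚ[k] → ℚ[k]
  - p = map (λ a → ℚ.- a) p

  _-_ : ℚ[k] → ℚ[k] → ℚ[k]
  p - q = p + - q

  _·_ : ℚ → ℚ[k] → ℚ[k]
  a · p = map (a ℚ.*_) p

  _*_ : ℚ[k] → ℚ[k] → ℚ[k]
  []      * q = []
  (a ∷ p) * q = a · q + (0ℚ ∷ p * q)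

  constant : ℕ → ℚ[k]
  constant n = + n ℚ./ 1 ∷ []

  k : ℚ[k]
  k = 0ℚ ∷ 1ℚ ∷ []

  0ₚ 1ₚ : ℚ[k]
  0ₚ = []
  1ₚ = 1ℚ ∷ []

  private
    coeff-+ : ∀ p q i → coeff (p + q) i ≡ coeff p i ℚ.+ coeff q i
    coeff-+ []      q       i       = ≡.sym (ℚ.+-identityˡ _)
    coeff-+ (a ∷ p) []      i       = ≡.sym (ℚ.+-identityʳ _)
    coeff-+ (a ∷ p) (b ∷ q) zero    = ≡.refl
    coeff-+ (a ∷ p) (b ∷ q) (suc i) = coeff-+ p q i

    coeff-neg : ∀ p i → coeff (- p) i ≡ ℚ.- coeff p i
    coeff-neg []      i       = ≡.refl
    coeff-neg (a ∷ p) zero    = ≡.refl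
    coeff-neg (a ∷ p) (suc i) = coeff-neg p i

    coeff-· : ∀ a p i → coeff (a · p) i ≡ a ℚ.* coeff p i
    coeff-· a []      i       = ≡.sym (ℚ.*-zeroʳ a)
    coeff-· a (b ∷ p) zero    = ≡.refl
    coeff-· a (b ∷ p) (suc i) = coeff-· a p i

    ≈-refl : ∀ {p} → p ≈ p
    ≈-refl = coeffwise λ _ → ≡.refl

    ≈-sym : ∀ {p q} → p ≈ q → q ≈ p
    ≈-sym e = coeffwise λ i → ≡.sym (at e i)

    ≈-trans : ∀ {p q r} → p ≈ q → q ≈ r → p ≈ r
    ≈-trans e f = coeffwise λ i → ≡.trans (at e i) (at f i)

    ∷-cong : ∀ {a b p q} → a ≡ b → p ≈ q → a ∷ p ≈ b ∷ q
    ∷-cong a≡b e = coeffwise λ { zero → a≡b ; (suc i) → at e i }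

    ∷-tail : ∀ {a b p q} → a ∷ p ≈ b ∷ q → p ≈ q
    ∷-tail e = coeffwise λ i → at e (suc i)

    0∷-zero : ∀ {p} → p ≈ [] → 0ℚ ∷ p ≈ []
    0∷-zero e = coeffwise λ { zero → ≡.refl ; (suc i) → at e i }

    +-cong : ∀ {p p′ q q′} → p ≈ p′ → q ≈ q′ → p + q ≈ p′ + q′
    +-cong {p} {p′} {q} {q′} e f = coeffwise λ i →
      ≡.trans (coeff-+ p q i) (≡.trans (≡.cong₂ ℚ._+_ (at e i) (at f i)) (≡.sym (coeff-+ p′ q′ i)))

    +-assoc : ∀ p q r → (p + q) + r ≈ p + (q + r)
    +-assoc p q r = coeffwise λ i → begin
      coeff ((p + q) + r) i                     ≡⟨ coeff-+ (p + q) r i ⟩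
      coeff (p + q) i ℚ.+ coeff r i             ≡⟨ ≡.cong (ℚ._+ coeff r i) (coeff-+ p q i) ⟩
      coeff p i ℚ.+ coeff q i ℚ.+ coeff r i     ≡⟨ ℚ.+-assoc (coeff p i) (coeff q i) (coeff r i) ⟩
      coeff p i ℚ.+ (coeff q i ℚ.+ coeff r i)   ≡⟨ ≡.cong (coeff p i ℚ.+_) (≡.sym (coeff-+ q r i)) ⟩
      coeff p i ℚ.+ coeff (q + r) i             ≡⟨ ≡.sym (coeff-+ p (q + r) i) ⟩
      coeff (p + (q + r)) i                     ∎
      where open ≡.≡-Reasoning

    +-comm : ∀ p q → p + q ≈ q + p
    +-comm p q = coeffwise λ i →
      ≡.trans (coeff-+ p q i) (≡.trans (ℚ.+-comm (coeff p i) (coeff q i)) (≡.sym (coeff-+ q p i)))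

    +-identityʳ : ∀ p → p + [] ≈ p
    +-identityʳ []      = ≈-refl
    +-identityʳ (_ ∷ _) = ≈-refl

    -‿cong : ∀ {p q} → p ≈ q → - p ≈ - q
    -‿cong {p} {q} e = coeffwise λ i →
      ≡.trans (coeff-neg p i) (≡.trans (≡.cong (λ a → ℚ.- a) (at e i)) (≡.sym (coeff-neg q i)))

    -‿inverseʳ : ∀ p → p + - p ≈ []
    -‿inverseʳ p = coeffwise λ i →
      ≡.trans (coeff-+ p (- p) i)
        (≡.trans (≡.cong (coeff p i ℚ.+_) (coeff-neg p i)) (ℚ.+-inverseʳ (coeff p i)))

    ·-cong : ∀ a {p q} → p ≈ q → a · p ≈ a · q
    ·-cong a {p} {q} e = coeffwise λ i →
      ≡.trans (coeff-· a p i) (≡.trans (≡.cong (a ℚ.*_) (at e i)) (≡.sym (coeff-· a q i)))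

    ·-distribˡ-+ : ∀ a p q → a · (p + q) ≈ a · p + a · q
    ·-distribˡ-+ a []      q       = ≈-refl
    ·-distribˡ-+ a (b ∷ p) []      = ≈-refl
    ·-distribˡ-+ a (b ∷ p) (d ∷ q) = ∷-cong (ℚ.*-distribˡ-+ a b d) (·-distribˡ-+ a p q)

    ·-distribʳ-+ : ∀ a b p → (a ℚ.+ b) · p ≈ a · p + b · p
    ·-distribʳ-+ a b []      = ≈-refl
    ·-distribʳ-+ a b (d ∷ p) = ∷-cong (ℚ.*-distribʳ-+ d a b) (·-distribʳ-+ a b p)

    ·-assoc : ∀ a b p → (a ℚ.* b) · p ≈ a · (b · p)
    ·-assoc a b []      = ≈-refl
    ·-assoc a b (d ∷ p) = ∷-cong (ℚ.*-assoc a b d) (·-assoc a b p)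

    0·-zero : ∀ p → 0ℚ · p ≈ []
    0·-zero p = coeffwise λ i → ≡.trans (coeff-· 0ℚ p i) (ℚ.*-zeroˡ (coeff p i))

    1·-identity : ∀ p → 1ℚ · p ≈ p
    1·-identity p = coeffwise λ i → ≡.trans (coeff-· 1ℚ p i) (ℚ.*-identityˡ (coeff p i))

    +-interchange : ∀ p q r s → (p + q) + (r + s) ≈ (p + r) + (q + s)
    +-interchange p q r s =
      ≈-trans (+-assoc p q (r + s))
        (≈-trans (+-cong (≈-refl {p}) (≈-trans (≈-sym (+-assoc q r s))
          (≈-trans (+-cong (+-comm q r) ≈-refl) (+-assoc r q s))))
          (≈-sym (+-assoc p r (q + s))))

    *-congˡ : ∀ p {q q′} → q ≈ q′ → p * q ≈ p * q′
    *-congˡ []      e = ≈-refl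
    *-congˡ (a ∷ p) e = +-cong (·-cong a e) (∷-cong ≡.refl (*-congˡ p e))

    *-zeroʳ : ∀ p → p * [] ≈ []
    *-zeroʳ []      = ≈-refl
    *-zeroʳ (a ∷ p) = 0∷-zero (*-zeroʳ p)

    *-∷ʳ : ∀ p b q → p * (b ∷ q) ≈ b · p + (0ℚ ∷ p * q)
    *-∷ʳ []      b q = ≈-sym (0∷-zero ≈-refl)
    *-∷ʳ (a ∷ p) b q = ∷-cong (≡.cong (ℚ._+ 0ℚ) (ℚ.*-comm a b))
      (≈-trans (+-cong ≈-refl (*-∷ʳ p b q))
        (≈-trans (≈-sym (+-assoc (a · q) (b · p) _))
          (≈-trans (+-cong (+-comm (a · q) (b · p)) ≈-refl)
            (+-assoc (b · p) (a · q) _))))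

    *-comm : ∀ p q → p * q ≈ q * p
    *-comm []      q = ≈-sym (*-zeroʳ q)
    *-comm (a ∷ p) q =
      ≈-trans (+-cong ≈-refl (∷-cong ≡.refl (*-comm p q))) (≈-sym (*-∷ʳ q a p))

    *-cong : ∀ {p p′ q q′} → p ≈ p′ → q ≈ q′ → p * q ≈ p′ * q′
    *-cong {p} {p′} {q} {q′} e f =
      ≈-trans (*-congˡ p f) (≈-trans (*-comm p q′) (≈-trans (*-congˡ q′ e) (*-comm q′ p′)))

    *-distribʳ-+ : ∀ r p q → (p + q) * r ≈ p * r + q * r
    *-distribʳ-+ r []      q       = ≈-refl
    *-distribʳ-+ r (a ∷ p) []      = ≈-sym (+-identityʳ _)
    *-distribʳ-+ r (a ∷ p) (b ∷ q) =
      ≈-trans (+-cong (·-distribʳ-+ a b r) (∷-cong ≡.refl (*-distribʳ-+ r p q)))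
        (+-interchange (a · r) (b · r) (0ℚ ∷ p * r) (0ℚ ∷ q * r))

    *-distribˡ-+ : ∀ r p q → r * (p + q) ≈ r * p + r * q
    *-distribˡ-+ r p q =
      ≈-trans (*-comm r (p + q))
        (≈-trans (*-distribʳ-+ r p q) (+-cong (*-comm p r) (*-comm q r)))

    0∷-* : ∀ p q → (0ℚ ∷ p) * q ≈ 0ℚ ∷ p * q
    0∷-* p q = +-cong (0·-zero q) ≈-refl

    ·-* : ∀ a p q → (a · p) * q ≈ a · (p * q)
    ·-* a []      q = ≈-refl
    ·-* a (b ∷ p) q =
      ≈-trans (+-cong (·-assoc a b q) (∷-cong (≡.sym (ℚ.*-zeroʳ a)) (·-* a p q)))
        (≈-sym (·-distribˡ-+ a (b · q) (0ℚ ∷ p * q)))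

    *-assoc : ∀ p q r → (p * q) * r ≈ p * (q * r)
    *-assoc []      q r = ≈-refl
    *-assoc (a ∷ p) q r =
      ≈-trans (*-distribʳ-+ r (a · q) (0ℚ ∷ p * q))
        (+-cong (·-* a q r) (≈-trans (0∷-* (p * q) r) (∷-cong ≡.refl (*-assoc p q r))))

    *-identityˡ : ∀ p → 1ₚ * p ≈ p
    *-identityˡ p = ≈-trans (+-cong (1·-identity p) (0∷-zero ≈-refl)) (+-identityʳ p)

  commutativeRing : CommutativeRing 0ℓ 0ℓ
  commutativeRing = record
    { Carrier = ℚ[k]
    ; _≈_     = _≈_
    ; _+_     = _+_
    ; _*_     = _*_
    ; -_      = -_
    ; 0#      = 0ₚ
    ; 1#      = 1ₚ
    ; isCommutativeRing = record
      { isRing = record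
        { +-isAbelianGroup = record
          { isGroup = record
            { isMonoid = record
              { isSemigroup = record
                { isMagma = record
                  { isEquivalence = record { refl = ≈-refl ; sym = ≈-sym ; trans = ≈-trans }
                  ; ∙-cong        = +-cong
                  }
                ; assoc = +-assoc
                }
              ; identity = (λ _ → ≈-refl) , +-identityʳ
              }
            ; inverse = (λ p → ≈-trans (+-comm (- p) p) (-‿inverseʳ p)) , -‿inverseʳ
            ; ⁻¹-cong = -‿cong
            }
          ; comm = +-comm
          }
        ; *-cong     = *-cong
        ; *-assoc    = *-assoc
        ; *-identity = *-identityˡ , (λ p → ≈-trans (*-comm p 1ₚ) (*-identityˡ p))
        ; distrib    = *-distribˡ-+ , *-distribʳ-+
        }
      ; *-comm = *-comm
      }
    }

  _≟_ : Decidable _≈_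
  []      ≟ []      = yes ≈-refl
  []      ≟ (b ∷ q) = map′ (λ (b≡0 , e) → ≈-sym (≈-trans (∷-cong b≡0 (≈-sym e)) (0∷-zero ≈-refl)))
                           (λ e → ≡.sym (at e 0) , coeffwise λ i → at e (suc i))
                           (b ℚ.≟ 0ℚ ×-dec [] ≟ q)
  (a ∷ p) ≟ []      = map′ (λ (a≡0 , e) → ≈-trans (∷-cong a≡0 e) (0∷-zero ≈-refl))
                           (λ e → at e 0 , coeffwise λ i → at e (suc i))
                           (a ℚ.≟ 0ℚ ×-dec p ≟ [])
  (a ∷ p) ≟ (b ∷ q) = map′ (λ (a≡b , e) → ∷-cong a≡b e)
                           (λ e → at e 0 , ∷-tail e)
                           (a ℚ.≟ b ×-dec p ≟ q)

  1≉0 : ¬ 1ₚ ≈ 0ₚ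
  1≉0 e with () ← at e 0

  private
    ℚ-noZeroDivisors : ∀ {a b} → a ℚ.* b ≡ 0ℚ → a ≢ 0ℚ → b ≡ 0ℚ
    ℚ-noZeroDivisors {a} {b} ab≡0 a≢0 = begin
      b                    ≡⟨ ≡.sym (ℚ.*-identityˡ b) ⟩
      1ℚ ℚ.* b             ≡⟨ ≡.cong (ℚ._* b) (≡.sym (ℚ.*-inverseˡ a)) ⟩
      ℚ.1/ a ℚ.* a ℚ.* b   ≡⟨ ℚ.*-assoc (ℚ.1/ a) a b ⟩
      ℚ.1/ a ℚ.* (a ℚ.* b) ≡⟨ ≡.cong (ℚ.1/ a ℚ.*_) ab≡0 ⟩
      ℚ.1/ a ℚ.* 0ℚ        ≡⟨ ℚ.*-zeroʳ (ℚ.1/ a) ⟩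
      0ℚ                   ∎
      where
      open ≡.≡-Reasoning
      instance _ = ℚ.≢-nonZero a≢0

    cancel-∷ : ∀ a p q → a ≢ 0ℚ → (a ∷ p) * q ≈ [] → q ≈ []
    cancel-∷ a p []      a≢0 e = ≈-refl
    cancel-∷ a p (b ∷ q) a≢0 e =
      ≈-trans (∷-cong b≡0 (cancel-∷ a p q a≢0 tail)) (0∷-zero ≈-refl)
      where
      b≡0 : b ≡ 0ℚ
      b≡0 = ℚ-noZeroDivisors (≡.trans (≡.sym (ℚ.+-identityʳ _)) (at e 0)) a≢0
      shifted : (a ∷ p) * (b ∷ q) ≈ 0ℚ ∷ (a ∷ p) * q
      shifted = ≈-trans (*-congˡ (a ∷ p) (∷-cong b≡0 (≈-refl {q})))
                  (≈-trans (*-comm (a ∷ p) (0ℚ ∷ q))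
                    (≈-trans (0∷-* q (a ∷ p)) (∷-cong ≡.refl (*-comm q (a ∷ p)))))
      tail : (a ∷ p) * q ≈ []
      tail = coeffwise λ i → at (≈-trans (≈-sym shifted) e) (suc i)

  noZeroDivisors : ∀ p q → p * q ≈ 0ₚ → p ≈ 0ₚ ⊎ q ≈ 0ₚ
  noZeroDivisors []      q e = inj₁ ≈-refl
  noZeroDivisors (a ∷ p) q e with a ℚ.≟ 0ℚ
  ... | no  a≢0    = inj₂ (cancel-∷ a p q a≢0 e)
  ... | yes ≡.refl with noZeroDivisors p q (coeffwise λ i → at (≈-trans (≈-sym (0∷-* p q)) e) (suc i))
  ...   | inj₁ p≈0 = inj₁ (0∷-zero p≈0)
  ...   | inj₂ q≈0 = inj₂ q≈0

module FractionField
  (R : CommutativeRing κ ℓ)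
  (_≈?_ : Decidable (CommutativeRing._≈_ R))
  (1≉0 : ¬ CommutativeRing._≈_ R (CommutativeRing.1# R) (CommutativeRing.0# R))
  (noZeroDivisors : ∀ x y → CommutativeRing._≈_ R (CommutativeRing._*_ R x y) (CommutativeRing.0# R) →
                    CommutativeRing._≈_ R x (CommutativeRing.0# R) ⊎ CommutativeRing._≈_ R y (CommutativeRing.0# R))
  where

  private
    module R = CommutativeRing R
  open R using (_≈_; _*_; _+_; -_; 0#; 1#)
  open IntegerSolver R

  infix 4 _≃_ _≟_

  record Fraction : Set (κ ⊔ ℓ) where
    constructor _/_⟨_⟩
    field
      num   : R.Carrier
      den   : R.Carrier
      den≉0 : ¬ den ≈ 0#
  open Fraction public

  record _≃_ (x y : Fraction) : Set ℓ where
    constructor cross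
    field cross-eq : num x * den y ≈ num y * den x
  open _≃_ public

  private
    *≉0 : ∀ {x y} → ¬ x ≈ 0# → ¬ y ≈ 0# → ¬ x * y ≈ 0#
    *≉0 x≉0 y≉0 e = [ x≉0 , y≉0 ]′ (noZeroDivisors _ _ e)

  _+ᶠ_ _*ᶠ_ : Fraction → Fraction → Fraction
  (a / s ⟨ s≉0 ⟩) +ᶠ (b / t ⟨ t≉0 ⟩) = (a * t + b * s) / s * t ⟨ *≉0 s≉0 t≉0 ⟩
  (a / s ⟨ s≉0 ⟩) *ᶠ (b / t ⟨ t≉0 ⟩) = (a * b) / s * t ⟨ *≉0 s≉0 t≉0 ⟩

  -ᶠ_ : Fraction → Fraction
  -ᶠ (a / s ⟨ s≉0 ⟩) = (- a) / s ⟨ s≉0 ⟩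

  ι : R.Carrier → Fraction
  ι a = a / 1# ⟨ 1≉0 ⟩

  0ᶠ 1ᶠ : Fraction
  0ᶠ = ι 0#
  1ᶠ = ι 1#

  private
    open SetoidReasoning R.setoid
    open GroupProperties R.+-group using (x∙y⁻¹≈ε⇒x≈y; x≈y⇒x∙y⁻¹≈ε)

    *-cancelʳ : ∀ {x y z} → ¬ z ≈ 0# → x * z ≈ y * z → x ≈ y
    *-cancelʳ {x} {y} {z} z≉0 e with noZeroDivisors (x + - y) z (R.trans
      (solve 3 (λ x y z → (x :- y) :* z := x :* z :- y :* z) R.refl x y z) (x≈y⇒x∙y⁻¹≈ε e))
    ... | inj₁ x-y≈0 = x∙y⁻¹≈ε⇒x≈y x y x-y≈0
    ... | inj₂ z≈0   = contradiction z≈0 z≉0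

    ≃-trans : ∀ {x y z} → x ≃ y → y ≃ z → x ≃ z
    ≃-trans {a / s ⟨ _ ⟩} {b / t ⟨ t≉0 ⟩} {d / u ⟨ _ ⟩} (cross e) (cross f) = cross (*-cancelʳ t≉0 (begin
      (a * u) * t   ≈⟨ solve 3 (λ a u t → (a :* u) :* t := (a :* t) :* u) R.refl a u t ⟩
      (a * t) * u   ≈⟨ R.*-congʳ e ⟩
      (b * s) * u   ≈⟨ solve 3 (λ b s u → (b :* s) :* u := (b :* u) :* s) R.refl b s u ⟩
      (b * u) * s   ≈⟨ R.*-congʳ f ⟩
      (d * t) * s   ≈⟨ solve 3 (λ d t s → (d :* t) :* s := (d :* s) :* t) R.refl d t s ⟩
      (d * s) * t   ∎))

    +-cong : ∀ {x x′ y y′} → x ≃ x′ → y ≃ y′ → (x +ᶠ y) ≃ (x′ +ᶠ y′)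
    +-cong {a / s ⟨ _ ⟩} {a′ / s′ ⟨ _ ⟩} {b / t ⟨ _ ⟩} {b′ / t′ ⟨ _ ⟩} (cross e) (cross f) = cross (begin
      (a * t + b * s) * (s′ * t′)
        ≈⟨ solve 6 (λ a s b t s′ t′ → (a :* t :+ b :* s) :* (s′ :* t′)
             := (a :* s′) :* (t :* t′) :+ (b :* t′) :* (s :* s′)) R.refl a s b t s′ t′ ⟩
      (a * s′) * (t * t′) + (b * t′) * (s * s′)
        ≈⟨ R.+-cong (R.*-congʳ e) (R.*-congʳ f) ⟩
      (a′ * s) * (t * t′) + (b′ * t) * (s * s′)
        ≈⟨ solve 6 (λ a′ s b′ t s′ t′ → (a′ :* s) :* (t :* t′) :+ (b′ :* t) :* (s :* s′)
             := (a′ :* t′ :+ b′ :* s′) :* (s :* t)) R.refl a′ s b′ t s′ t′ ⟩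
      (a′ * t′ + b′ * s′) * (s * t) ∎)

    *-cong : ∀ {x x′ y y′} → x ≃ x′ → y ≃ y′ → (x *ᶠ y) ≃ (x′ *ᶠ y′)
    *-cong {a / s ⟨ _ ⟩} {a′ / s′ ⟨ _ ⟩} {b / t ⟨ _ ⟩} {b′ / t′ ⟨ _ ⟩} (cross e) (cross f) = cross (begin
      (a * b) * (s′ * t′)   ≈⟨ swap a b s′ t′ ⟩
      (a * s′) * (b * t′)   ≈⟨ R.*-cong e f ⟩
      (a′ * s) * (b′ * t)   ≈⟨ swap a′ s b′ t ⟩
      (a′ * b′) * (s * t)   ∎)
      where
      swap : ∀ w x y z → (w * x) * (y * z) ≈ (w * y) * (x * z)
      swap = solve 4 (λ w x y z → (w :* x) :* (y :* z) := (w :* y) :* (x :* z)) R.refl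

    -‿cong : ∀ {x y} → x ≃ y → (-ᶠ x) ≃ (-ᶠ y)
    -‿cong {a / s ⟨ _ ⟩} {b / t ⟨ _ ⟩} (cross e) = cross (begin
      (- a) * t   ≈⟨ neg a t ⟩
      - (a * t)   ≈⟨ R.-‿cong e ⟩
      - (b * s)   ≈⟨ neg b s ⟨
      (- b) * s   ∎)
      where
      neg : ∀ x y → (- x) * y ≈ - (x * y)
      neg = solve 2 (λ x y → (:- x) :* y := :- (x :* y)) R.refl

    +-assoc : ∀ x y z → ((x +ᶠ y) +ᶠ z) ≃ (x +ᶠ (y +ᶠ z))
    +-assoc (a / s ⟨ _ ⟩) (b / t ⟨ _ ⟩) (d / u ⟨ _ ⟩) = cross (solve 6 (λ a s b t d u →
      ((a :* t :+ b :* s) :* u :+ d :* (s :* t)) :* (s :* (t :* u))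
        := (a :* (t :* u) :+ (b :* u :+ d :* t) :* s) :* ((s :* t) :* u)) R.refl a s b t d u)

    +-comm : ∀ x y → (x +ᶠ y) ≃ (y +ᶠ x)
    +-comm (a / s ⟨ _ ⟩) (b / t ⟨ _ ⟩) = cross (solve 4 (λ a s b t →
      (a :* t :+ b :* s) :* (t :* s) := (b :* s :+ a :* t) :* (s :* t)) R.refl a s b t)

    +-identityˡ : ∀ x → (0ᶠ +ᶠ x) ≃ x
    +-identityˡ (a / s ⟨ _ ⟩) = cross (solve 3 (λ a s o →
      (con +0 :* s :+ a :* o) :* s := a :* (o :* s)) R.refl a s 1#)

    -‿inverseˡ : ∀ x → ((-ᶠ x) +ᶠ x) ≃ 0ᶠ
    -‿inverseˡ (a / s ⟨ _ ⟩) = cross (solve 3 (λ a s o →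
      ((:- a) :* s :+ a :* s) :* o := con +0 :* (s :* s)) R.refl a s 1#)

    *-assoc : ∀ x y z → ((x *ᶠ y) *ᶠ z) ≃ (x *ᶠ (y *ᶠ z))
    *-assoc (a / s ⟨ _ ⟩) (b / t ⟨ _ ⟩) (d / u ⟨ _ ⟩) = cross (solve 6 (λ a s b t d u →
      ((a :* b) :* d) :* (s :* (t :* u)) := (a :* (b :* d)) :* ((s :* t) :* u)) R.refl a s b t d u)

    *-comm : ∀ x y → (x *ᶠ y) ≃ (y *ᶠ x)
    *-comm (a / s ⟨ _ ⟩) (b / t ⟨ _ ⟩) = cross (solve 4 (λ a s b t →
      (a :* b) :* (t :* s) := (b :* a) :* (s :* t)) R.refl a s b t)

    *-identityˡ : ∀ x → (1ᶠ *ᶠ x) ≃ x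
    *-identityˡ (a / s ⟨ _ ⟩) = cross (solve 3 (λ a s o →
      (o :* a) :* s := a :* (o :* s)) R.refl a s 1#)

    distribˡ : ∀ x y z → (x *ᶠ (y +ᶠ z)) ≃ ((x *ᶠ y) +ᶠ (x *ᶠ z))
    distribˡ (a / s ⟨ _ ⟩) (b / t ⟨ _ ⟩) (d / u ⟨ _ ⟩) = cross (solve 6 (λ a s b t d u →
      (a :* (b :* u :+ d :* t)) :* ((s :* t) :* (s :* u))
        := ((a :* b) :* (s :* u) :+ (a :* d) :* (s :* t)) :* (s :* (t :* u))) R.refl a s b t d u)

    distribʳ : ∀ x y z → ((y +ᶠ z) *ᶠ x) ≃ ((y *ᶠ x) +ᶠ (z *ᶠ x))
    distribʳ x y z = ≃-trans (*-comm (y +ᶠ z) x)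
      (≃-trans (distribˡ x y z) (+-cong (*-comm x y) (*-comm x z)))

  commutativeRing : CommutativeRing (κ ⊔ ℓ) ℓ
  commutativeRing = record
    { Carrier = Fraction
    ; _≈_     = _≃_
    ; _+_     = _+ᶠ_
    ; _*_     = _*ᶠ_
    ; -_      = -ᶠ_
    ; 0#      = 0ᶠ
    ; 1#      = 1ᶠ
    ; isCommutativeRing = record
      { isRing = record
        { +-isAbelianGroup = record
          { isGroup = record
            { isMonoid = record
              { isSemigroup = record
                { isMagma = record
                  { isEquivalence = record
                    { refl  = cross R.refl
                    ; sym   = λ (cross e) → cross (R.sym e)
                    ; trans = ≃-trans
                    }
                  ; ∙-cong = +-cong
                  }
                ; assoc = +-assoc
                }
              ; identity = +-identityˡ , λ x → ≃-trans (+-comm x 0ᶠ) (+-identityˡ x)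
              }
            ; inverse = -‿inverseˡ , λ x → ≃-trans (+-comm x (-ᶠ x)) (-‿inverseˡ x)
            ; ⁻¹-cong = -‿cong
            }
          ; comm = +-comm
          }
        ; *-cong     = *-cong
        ; *-assoc    = *-assoc
        ; *-identity = *-identityˡ , λ x → ≃-trans (*-comm x 1ᶠ) (*-identityˡ x)
        ; distrib    = distribˡ , distribʳ
        }
      ; *-comm = *-comm
      }
    }

  _≟_ : Decidable _≃_
  x ≟ y = map′ cross cross-eq ((num x * den y) ≈? (num y * den x))

  private
    module F = CommutativeRing commutativeRing

    decSetoid : DecSetoid (κ ⊔ ℓ) ℓ
    decSetoid = record
      { isDecEquivalence = record { isEquivalence = F.isEquivalence ; _≟_ = _≟_ } }

    open DecSetoidProperties decSetoid using (≉-isApartnessRelation; ≉-tight)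

  heytingField : HeytingField (κ ⊔ ℓ) ℓ ℓ
  heytingField = record
    { _#_ = F._≉_
    ; isHeytingField = record
      { isHeytingCommutativeRing = record
        { isCommutativeRing   = F.isCommutativeRing
        ; isApartnessRelation = ≉-isApartnessRelation
        ; #⇒invertible        = λ {x} {y} x≉y →
            let n = num (x F.- y)
                d = den (x F.- y)
                n≉0 : ¬ n ≈ 0#
                n≉0 n≈0 = x≉y (cross (x∙y⁻¹≈ε⇒x≈y _ _ (R.trans
                  (solve 4 (λ a s b t → a :* t :- b :* s := a :* t :+ (:- b) :* s)
                    R.refl (num x) (den x) (num y) (den y)) n≈0)))
                inverse : (d / n ⟨ n≉0 ⟩) F.* (x F.- y) F.≈ 1ᶠ
                inverse = cross (solve 3 (λ n d o → (d :* n) :* o := o :* (n :* d)) R.refl n d 1#)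
            in (d / n ⟨ n≉0 ⟩) , inverse , F.trans (F.*-comm (x F.- y) (d / n ⟨ n≉0 ⟩)) inverse
        ; invertible⇒#        = λ {x} {y} (r , r[x-y]≈1 , _) x≈y → 1≉0 (begin
            1#                  ≈⟨ R.*-identityʳ 1# ⟨
            1# * 1#             ≈⟨ cross-eq (F.trans (F.sym r[x-y]≈1) (F.trans
                                     (F.*-congˡ {r} (GroupProperties.x≈y⇒x∙y⁻¹≈ε F.+-group x≈y)) (F.zeroʳ r))) ⟩
            0# * 1#             ≈⟨ R.zeroˡ 1# ⟩
            0#                  ∎)
        }
      ; tight = ≉-tight
      }
    }

-- The curve y² = (x + α)(x + β)(x + γ), in characteristic ≠ 2; it is smooth
-- exactly when α, β and γ are distinct.
record EllipticCurve {κ ℓ₁ ℓ₂} (K : HeytingField κ ℓ₁ ℓ₂) : Set (κ ⊔ ℓ₂) where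
  open HeytingField K
  field
    α β γ : Carrier
    α#β   : α # β
    β#γ   : β # γ
    α#γ   : α # γ

module Points
  {κ ℓ₁ ℓ₂} (K : HeytingField κ ℓ₁ ℓ₂)
  (_#?_ : Decidable (HeytingField._#_ K))
  (E : EllipticCurve K)
  where

  open HeytingField K
  open EllipticCurve E
  private
    R : CommutativeRing κ ℓ₁
    R = record { isCommutativeRing = isCommutativeRing }
    open CommutativeRing R using (+-group)
    open IntegerSolver R
    open SetoidReasoning setoid
    open GroupProperties +-group using (x∙y⁻¹≈ε⇒x≈y; x≈y⇒x∙y⁻¹≈ε)

  f f′ : Carrier → Carrier
  f  x = (x + α) * (x + β) * (x + γ)
  f′ x = (x + β) * (x + γ) + (x + α) * (x + γ) + (x + α) * (x + β)

  data Point : Set (κ ⊔ ℓ₁) where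
    ∞      : Point
    affine : ∀ x y → y * y ≈ f x → Point

  data _≈ᴾ_ : Point → Point → Set (κ ⊔ ℓ₁) where
    ∞      : ∞ ≈ᴾ ∞
    affine : ∀ {x y x′ y′ e e′} → x ≈ x′ → y ≈ y′ → affine x y e ≈ᴾ affine x′ y′ e′

  -ᴾ_ : Point → Point
  -ᴾ ∞            = ∞
  -ᴾ affine x y e = affine x (- y)
    (trans (solve 1 (λ y → (:- y) :* (:- y) := y :* y) refl y) e)

  -- A line of slope m through (x₁ , y₁) and (x₂ , y₂) meets the curve in a
  -- third point with abscissa thirdX m x₁ x₂, whose reflection in the x-axis
  -- has ordinate reflectedY m x₁ y₁ x₃.
  thirdX : Carrier → Carrier → Carrier → Carrier
  thirdX m x₁ x₂ = m * m - (α + β + γ) - x₁ - x₂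

  reflectedY : Carrier → Carrier → Carrier → Carrier → Carrier
  reflectedY m x₁ y₁ x₃ = m * (x₁ - x₃) - y₁

  chordSlope : ∀ {x₁ x₂} (y₁ y₂ : Carrier) → x₁ # x₂ → Carrier
  chordSlope y₁ y₂ x₁#x₂ = (y₁ - y₂) * proj₁ (#⇒invertible x₁#x₂)

  -- f′ is the derivative of f. Used when (x₁ , y₁) ≈ (x₂ , y₂), where y₁ - - y₂ is 2y₁.
  tangentSlope : ∀ (x₁ : Carrier) {y₁ y₂} → y₁ # - y₂ → Carrier
  tangentSlope x₁ y₁#-y₂ = f′ x₁ * proj₁ (#⇒invertible y₁#-y₂)

  private
    *-cancelʳ : ∀ {x y} z → (∃[ w ] z * w ≈ 1#) → x * z ≈ y * z → x ≈ y
    *-cancelʳ {x} {y} z (w , zw≈1) e = begin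
      x             ≈⟨ sym (*-identityʳ x) ⟩
      x * 1#        ≈⟨ *-congˡ (sym zw≈1) ⟩
      x * (z * w)   ≈⟨ sym (*-assoc x z w) ⟩
      x * z * w     ≈⟨ *-congʳ e ⟩
      y * z * w     ≈⟨ *-assoc y z w ⟩
      y * (z * w)   ≈⟨ *-congˡ zw≈1 ⟩
      y * 1#        ≈⟨ *-identityʳ y ⟩
      y             ∎

    slope-eq : ∀ {u x y} (x#y : x # y) → u * proj₁ (#⇒invertible x#y) * (x - y) ≈ u
    slope-eq {u} x#y with w , w[x-y]≈1 , _ ← #⇒invertible x#y =
      trans (*-assoc u w _) (trans (*-congˡ w[x-y]≈1) (*-identityʳ u))

    vanish₃ : ∀ {p q r u v w} → u ≈ 0# → v ≈ 0# → w ≈ 0# → p * u + q * v + r * w ≈ 0#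
    vanish₃ {p} {q} {r} u≈0 v≈0 w≈0 = begin
      _                          ≈⟨ +-cong (+-cong (*-congˡ u≈0) (*-congˡ v≈0)) (*-congˡ w≈0) ⟩
      p * 0# + q * 0# + r * 0#   ≈⟨ solve 3 (λ p q r → p :* con +0 :+ q :* con +0 :+ r :* con +0 := con +0)
                                      refl p q r ⟩
      0#                         ∎

    abscissa : ∀ m x₁ x₂ → (α + β + γ) - m * m + x₁ + x₂ + thirdX m x₁ x₂ ≈ 0#
    abscissa m x₁ x₂ = solve 6 (λ α β γ m x₁ x₂ →
      (α :+ β :+ γ) :- m :* m :+ x₁ :+ x₂ :+ (m :* m :- (α :+ β :+ γ) :- x₁ :- x₂) := con +0)
      refl α β γ m x₁ x₂

  chord-onCurve : ∀ {x₁ y₁ x₂ y₂} → y₁ * y₁ ≈ f x₁ → y₂ * y₂ ≈ f x₂ → (x₁#x₂ : x₁ # x₂) →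
                  let m  = chordSlope y₁ y₂ x₁#x₂
                      x₃ = thirdX m x₁ x₂
                      y₃ = reflectedY m x₁ y₁ x₃
                  in y₃ * y₃ ≈ f x₃
  chord-onCurve {x₁} {y₁} {x₂} {y₂} e₁ e₂ x₁#x₂ =
    *-cancelʳ (x₁ - x₂) (proj₁ (#⇒invertible x₁#x₂) , proj₂ (proj₂ (#⇒invertible x₁#x₂)))
      (x∙y⁻¹≈ε⇒x≈y _ _ (begin
        y₃ * y₃ * (x₁ - x₂) - f x₃ * (x₁ - x₂)
          ≈⟨ solve 8 (λ α β γ m x₁ y₁ x₂ x₃ →
               let f  = λ x → (x :+ α) :* (x :+ β) :* (x :+ γ)
                   y₃ = m :* (x₁ :- x₃) :- y₁
                   y₂ = y₁ :- m :* (x₁ :- x₂)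
               in y₃ :* y₃ :* (x₁ :- x₂) :- f x₃ :* (x₁ :- x₂)
                  := (x₃ :- x₂) :* (y₁ :* y₁ :- f x₁) :+ (x₁ :- x₃) :* (y₂ :* y₂ :- f x₂)
                     :+ ((x₃ :- x₂) :* (x₁ :* x₁) :+ (x₁ :- x₃) :* (x₂ :* x₂) :- (x₁ :- x₂) :* (x₃ :* x₃))
                        :* ((α :+ β :+ γ) :- m :* m :+ x₁ :+ x₂ :+ x₃))
               refl α β γ m x₁ y₁ x₂ x₃ ⟩
        (x₃ - x₂) * (y₁ * y₁ - f x₁) + (x₁ - x₃) * (y₂′ * y₂′ - f x₂)
          + _ * ((α + β + γ) - m * m + x₁ + x₂ + x₃)
          ≈⟨ vanish₃ (x≈y⇒x∙y⁻¹≈ε e₁)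
               (x≈y⇒x∙y⁻¹≈ε (trans (*-cong y₂′≈y₂ y₂′≈y₂) e₂)) (abscissa m x₁ x₂) ⟩
        0# ∎))
    where
    m   = chordSlope y₁ y₂ x₁#x₂
    x₃  = thirdX m x₁ x₂
    y₃  = reflectedY m x₁ y₁ x₃
    y₂′ = y₁ - m * (x₁ - x₂)
    y₂′≈y₂ : y₂′ ≈ y₂
    y₂′≈y₂ = trans (+-congˡ (-‿cong (slope-eq x₁#x₂)))
      (solve 2 (λ y₁ y₂ → y₁ :- (y₁ :- y₂) := y₂) refl y₁ y₂)

  tangent-onCurve : ∀ {x₁ y₁ x₂ y₂} → y₁ * y₁ ≈ f x₁ → y₂ * y₂ ≈ f x₂ → x₁ ≈ x₂ → (y₁#-y₂ : y₁ # - y₂) →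
                    let m  = tangentSlope x₁ y₁#-y₂
                        x₃ = thirdX m x₁ x₂
                        y₃ = reflectedY m x₁ y₁ x₃
                    in y₃ * y₃ ≈ f x₃
  tangent-onCurve {x₁} {y₁} {x₂} {y₂} e₁ e₂ x₁≈x₂ y₁#-y₂ = x∙y⁻¹≈ε⇒x≈y _ _ (begin
    y₃ * y₃ - f x₃
      ≈⟨ solve 7 (λ α β γ m x₁ y₁ x₃ →
           let f  = λ x → (x :+ α) :* (x :+ β) :* (x :+ γ)
               f′ = λ x → (x :+ β) :* (x :+ γ) :+ (x :+ α) :* (x :+ γ) :+ (x :+ α) :* (x :+ β)
               y₃ = m :* (x₁ :- x₃) :- y₁
           in y₃ :* y₃ :- f x₃
              := con (+ 1) :* (y₁ :* y₁ :- f x₁) :+ (x₃ :- x₁) :* (m :* (y₁ :- :- y₁) :- f′ x₁)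
                 :+ (:- ((x₃ :- x₁) :* (x₃ :- x₁))) :* ((α :+ β :+ γ) :- m :* m :+ x₁ :+ x₁ :+ x₃))
           refl α β γ m x₁ y₁ x₃ ⟩
    _ * (y₁ * y₁ - f x₁) + (x₃ - x₁) * (m * (y₁ - - y₁) - f′ x₁)
      + _ * ((α + β + γ) - m * m + x₁ + x₁ + x₃)
      ≈⟨ vanish₃ (x≈y⇒x∙y⁻¹≈ε e₁)
           (x≈y⇒x∙y⁻¹≈ε (trans (*-congˡ (+-congˡ (-‿cong (-‿cong y₁≈y₂)))) (slope-eq y₁#-y₂)))
           (trans (+-congʳ (+-congˡ x₁≈x₂)) (abscissa m x₁ x₂)) ⟩
    0# ∎)
    where
    m  = tangentSlope x₁ y₁#-y₂
    x₃ = thirdX m x₁ x₂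
    y₃ = reflectedY m x₁ y₁ x₃
    f-cong : f x₂ ≈ f x₁
    f-cong = *-cong (*-cong (+-congʳ (sym x₁≈x₂)) (+-congʳ (sym x₁≈x₂))) (+-congʳ (sym x₁≈x₂))
    y₁≈y₂ : y₁ ≈ y₂
    y₁≈y₂ = *-cancelʳ (y₁ - - y₂) (proj₁ (#⇒invertible y₁#-y₂) , proj₂ (proj₂ (#⇒invertible y₁#-y₂)))
      (x∙y⁻¹≈ε⇒x≈y _ _ (trans
        (solve 2 (λ y₁ y₂ → y₁ :* (y₁ :- :- y₂) :- y₂ :* (y₁ :- :- y₂) := y₁ :* y₁ :- y₂ :* y₂) refl y₁ y₂)
        (x≈y⇒x∙y⁻¹≈ε (trans e₁ (sym (trans e₂ f-cong))))))

  _+ᴾ_ : Point → Point → Point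
  ∞               +ᴾ Q               = Q
  P@(affine _ _ _) +ᴾ ∞              = P
  affine x₁ y₁ e₁ +ᴾ affine x₂ y₂ e₂ with x₁ #? x₂ | y₁ #? (- y₂)
  ... | yes x₁#x₂ | _          = affine _ _ (chord-onCurve e₁ e₂ x₁#x₂)
  ... | no ¬x₁#x₂ | yes y₁#-y₂ = affine _ _ (tangent-onCurve e₁ e₂ (proj₁ (tight x₁ x₂) ¬x₁#x₂) y₁#-y₂)
  ... | no _      | no  _      = ∞

  MordellWeil : RawGroup (κ ⊔ ℓ₁) (κ ⊔ ℓ₁)
  MordellWeil = record
    { Carrier = Point
    ; _≈_     = _≈ᴾ_
    ; _∙_     = _+ᴾ_
    ; ε       = ∞
    ; _⁻¹     = -ᴾ_
    }

-- Meant for abelian groups: the rank is the maximal number of ℤ-linearly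
-- independent elements. The raw bundle suffices to express this.
module Rank (G : RawGroup κ ℓ) where
  open RawGroup G
  open RawMonoidDefinitions rawMonoid using (sum) renaming (_×_ to _×ᴺ_)

  _·_ : ℤ → Carrier → Carrier
  (+ n)    · g = n ×ᴺ g
  -[1+ n ] · g = (suc n ×ᴺ g) ⁻¹

  LinearlyIndependent : ∀ {r} → (Fin r → Carrier) → Set ℓ
  LinearlyIndependent {r} g = ∀ (n : Fin r → ℤ) → sum (λ i → n i · g i) ≈ ε → ∀ i → n i ≡ +0

  rank≥ : ℕ → Set (κ ⊔ ℓ)
  rank≥ r = ∃[ g ] LinearlyIndependent {r} g

module ℚ⟨k⟩ = FractionField Polynomial.commutativeRing Polynomial._≟_ Polynomial.1≉0 Polynomial.noZeroDivisors

ℚ⟨k⟩ : HeytingField 0ℓ 0ℓ 0ℓ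
ℚ⟨k⟩ = ℚ⟨k⟩.heytingField

_#?_ : Decidable (HeytingField._#_ ℚ⟨k⟩)
x #? y = ¬? (x ℚ⟨k⟩.≟ y)

module _ where
  open Polynomial

  a b c : ℚ[k]
  a = constant 10 * (k * k) - constant 8 * k + constant 8
  b = k * (k * k - constant 4 * k + constant 20)
  c = (k + constant 2) * (k * k - constant 4)

module _ where
  open HeytingField ℚ⟨k⟩ using (_*_)
  open ℚ⟨k⟩ using (ι)

  E : EllipticCurve ℚ⟨k⟩
  E = record
    { α   = ι a * ι b
    ; β   = ι b * ι c
    ; γ   = ι a * ι c
    ; α#β = from-no (ι a * ι b ℚ⟨k⟩.≟ ι b * ι c)
    ; β#γ = from-no (ι b * ι c ℚ⟨k⟩.≟ ι a * ι c)
    ; α#γ = from-no (ι a * ι b ℚ⟨k⟩.≟ ι a * ι c)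
    }

E[ℚ⟨k⟩] : RawGroup 0ℓ 0ℓ
E[ℚ⟨k⟩] = Points.MordellWeil ℚ⟨k⟩ _#?_ E

{-# OPTIONS --safe #-}

module Submission where

open import Algebra.Apartness.Bundles using (HeytingField)
import Algebra.Apartness.Properties.HeytingCommutativeRing as HeytingProperties
open import Algebra.Bundles using (CommutativeRing; RawGroup)
import Algebra.Definitions.RawMonoid as RawMonoidDefinitions
import Algebra.Properties.CommutativeSemigroup as CommutativeSemigroupProperties
import Algebra.Properties.Group as GroupProperties
import Algebra.Properties.Semiring.Mult as SemiringMult
open import Data.Fin.Base using (Fin; zero; suc)
open import Data.Integer.Base as ℤ using (ℤ; +_; -[1+_]; +0)
open import Data.List.Base using (List; []; _∷_; map)
open import Data.Nat.Base as ℕ using (ℕ; zero; suc; NonZero)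
open import Data.Nat.Divisibility using (_∣_; _∤_; ∣1⇒≡1; m∣m*n; ∣m⇒∣m*n; ∣n⇒∣m*n; _∣?_)
open import Data.Nat.Primality using (Prime; prime?; euclidsLemma; ¬prime[1])
import Data.Nat.Properties as ℕ
open import Data.Product.Base using (_×_; _,_; proj₁; proj₂)
open import Data.Rational.Base as ℚ using (ℚ; 0ℚ; 1ℚ)
import Data.Rational.Properties as ℚ
open import Data.Sum.Base using ([_,_]′)
open import Level using (Level; 0ℓ; _⊔_)
open import Relation.Binary.Definitions using (Decidable)
open import Relation.Binary.PropositionalEquality as ≡ using (_≡_; _≢_)
import Relation.Binary.Reasoning.Setoid as SetoidReasoning
open import Relation.Nullary.Decidable using (Dec; yes; no; map′; from-yes; from-no)
open import Relation.Nullary.Negation using (contradiction)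

open import Defs using (E[ℚ⟨k⟩]; module Rank; module IntegerSolver; module Points; module Polynomial; EllipticCurve; ℚ⟨k⟩; module ℚ⟨k⟩; E; _#?_; a; b; c)

-- After scaling x by k⁶ and y by k⁹, the curve acquires at k = ∞ the split nodal
-- reduction y² = x²(x + 1). A point reducing to a smooth point (x , y) of the
-- nodal cubic is sent to u = (y - x)/(y + x), which turns addition into
-- multiplication in ℚ*. One bihomogeneous addition law proves this for all pairs
-- of points with u₁ ≠ -u₂, in particular for those with u₁, u₂ > 0, and no
-- further property of the group law (such as associativity) is needed. There
-- are points G₁ and G₂ with u = 3 and u = 9/5. A relation mG₁ + nG₂ = ∞ gives
-- 3ᵐ(9/5)ⁿ = 1, whence m = n = 0.

private
  variable
    κ λ′ ℓ₁ ℓ₂ : Level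

-- The addition law as formulas over bare operations.

record Operations (A : Set κ) : Set κ where
  infixl 7 _*_
  infixl 6 _+_ _-_
  field
    _+_ _*_ _-_ : A → A → A
    # : ℕ → A

-- The addition law on y²z = x³ + e₁x²z + e₂xz² + e₃z³ of bidegree (2, 2) whose
-- exceptional pairs are those differing by a point of order exactly 2. It is
-- written for bare operations so that it applies to solver syntax as well.
module AdditionLaw {A : Set κ} (O : Operations A) (e₁ e₂ e₃ X₁ Y₁ Z₁ X₂ Y₂ Z₂ : A) where
  open Operations O

  xx xy xz yy yz zz X₃ Y₃ Z₃ : A
  xx = X₁ * X₂
  xy = X₁ * Y₂ + Y₁ * X₂
  xz = X₁ * Z₂ + Z₁ * X₂
  yy = Y₁ * Y₂
  yz = Y₁ * Z₂ + Z₁ * Y₂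
  zz = Z₁ * Z₂
  X₃ = xy * (yy - e₁ * xx - e₂ * xz - # 3 * e₃ * zz)
       - yz * (e₂ * xx + # 3 * e₃ * xz + (# 4 * e₁ * e₃ - e₂ * e₂) * zz)
  Y₃ = yy * yy
       + (# 3 * e₂ - e₁ * e₁) * (xx * xx)
       + (# 9 * e₃ - e₁ * e₂) * (xx * xz)
       + (# 6 * e₁ * e₃ - # 2 * e₂ * e₂) * (xx * zz)
       + (# 3 * e₁ * e₃ - e₂ * e₂) * (xz * xz)
       + (# 4 * e₁ * e₁ * e₃ - e₁ * e₂ * e₂ - # 3 * e₂ * e₃) * (xz * zz)
       + (# 4 * e₁ * e₂ * e₃ - e₂ * e₂ * e₂ - # 9 * e₃ * e₃) * (zz * zz)
  Z₃ = yz * (yy + e₁ * xx + e₂ * xz + # 3 * e₃ * zz)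
       + xy * (# 3 * xx + e₁ * xz + e₂ * zz)

-- The summands lie on the line y = mx + n, which meets the curve at x₁, x₂ and
-- x₃, so that Vieta's formulas express the coefficients of the curve. This
-- covers chords and tangents alike.
module AdditionOnLine {A : Set κ} (O : Operations A) (x₁ x₂ x₃ m n Z₁ Z₂ : A) where
  open Operations O
  open AdditionLaw O (m * m - (x₁ + x₂ + x₃)) (x₁ * x₂ + x₁ * x₃ + x₂ * x₃ + # 2 * m * n) (n * n - x₁ * x₂ * x₃)
    (x₁ * Z₁) ((m * x₁ + n) * Z₁) Z₁ (x₂ * Z₂) ((m * x₂ + n) * Z₂) Z₂ public

-- Homogeneity of the addition law.

-- L w d relates elements of weight w + d. The shift d is kept apart because the
-- weights of projective coordinates are only determined up to a common shift.
record GradedRelation {A : Set κ} {B : Set λ′} (O : Operations A) (O′ : Operations B) ℓ : Set (κ ⊔ λ′ ⊔ Level.suc ℓ) where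
  infixl 7 _⟨*⟩_
  infixl 6 _⟨+⟩_ _⟨-⟩_
  private
    module O  = Operations O
    module O′ = Operations O′
  field
    L     : ℕ → ℕ → A → B → Set ℓ
    _⟨+⟩_ : ∀ {w d x y x′ y′} → L w d x x′ → L w d y y′ → L w d (x O.+ y) (x′ O′.+ y′)
    _⟨-⟩_ : ∀ {w d x y x′ y′} → L w d x x′ → L w d y y′ → L w d (x O.- y) (x′ O′.- y′)
    _⟨*⟩_ : ∀ {w d v e x y x′ y′} → L w d x x′ → L v e y y′ → L (w ℕ.+ v) (d ℕ.+ e) (x O.* y) (x′ O′.* y′)
    ⟨#⟩   : ∀ n → L 0 0 (O.# n) (O′.# n)

module AdditionLawRelated
  {A : Set κ} {B : Set λ′} {O : Operations A} {O′ : Operations B} (G : GradedRelation O O′ ℓ₁)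
  where
  open GradedRelation G

  module Related
    {d₁ d₂ : ℕ}
    {e₁ e₂ e₃ X₁ Y₁ Z₁ X₂ Y₂ Z₂} {e₁′ e₂′ e₃′ X₁′ Y₁′ Z₁′ X₂′ Y₂′ Z₂′}
    (E₁ : L 6 0 e₁ e₁′) (E₂ : L 12 0 e₂ e₂′) (E₃ : L 18 0 e₃ e₃′)
    (U₁ : L 6 d₁ X₁ X₁′) (V₁ : L 9 d₁ Y₁ Y₁′) (W₁ : L 0 d₁ Z₁ Z₁′)
    (U₂ : L 6 d₂ X₂ X₂′) (V₂ : L 9 d₂ Y₂ Y₂′) (W₂ : L 0 d₂ Z₂ Z₂′)
    where
    private
      module S  = AdditionLaw O  e₁  e₂  e₃  X₁  Y₁  Z₁  X₂  Y₂  Z₂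
      module S′ = AdditionLaw O′ e₁′ e₂′ e₃′ X₁′ Y₁′ Z₁′ X₂′ Y₂′ Z₂′
      D : ℕ
      D = d₁ ℕ.+ d₂
      xx = U₁ ⟨*⟩ U₂
      xy = U₁ ⟨*⟩ V₂ ⟨+⟩ V₁ ⟨*⟩ U₂
      xz = U₁ ⟨*⟩ W₂ ⟨+⟩ W₁ ⟨*⟩ U₂
      yy = V₁ ⟨*⟩ V₂
      yz = V₁ ⟨*⟩ W₂ ⟨+⟩ W₁ ⟨*⟩ V₂
      zz = W₁ ⟨*⟩ W₂

    -- The law is homogeneous when X, Y, Z weigh 6, 9, 0 and the i-th coefficient weighs 6i. The
    -- weights 33, 36, 27 of the sum are again 6, 9, 0, up to a common shift by 27.
    X₃ : L 33 (D ℕ.+ D) S.X₃ S′.X₃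
    X₃ = xy ⟨*⟩ (yy ⟨-⟩ E₁ ⟨*⟩ xx ⟨-⟩ E₂ ⟨*⟩ xz ⟨-⟩ ⟨#⟩ 3 ⟨*⟩ E₃ ⟨*⟩ zz)
         ⟨-⟩ yz ⟨*⟩ (E₂ ⟨*⟩ xx ⟨+⟩ ⟨#⟩ 3 ⟨*⟩ E₃ ⟨*⟩ xz ⟨+⟩ (⟨#⟩ 4 ⟨*⟩ E₁ ⟨*⟩ E₃ ⟨-⟩ E₂ ⟨*⟩ E₂) ⟨*⟩ zz)

    Y₃ : L 36 (D ℕ.+ D) S.Y₃ S′.Y₃
    Y₃ = yy ⟨*⟩ yy
         ⟨+⟩ (⟨#⟩ 3 ⟨*⟩ E₂ ⟨-⟩ E₁ ⟨*⟩ E₁) ⟨*⟩ (xx ⟨*⟩ xx)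
         ⟨+⟩ (⟨#⟩ 9 ⟨*⟩ E₃ ⟨-⟩ E₁ ⟨*⟩ E₂) ⟨*⟩ (xx ⟨*⟩ xz)
         ⟨+⟩ (⟨#⟩ 6 ⟨*⟩ E₁ ⟨*⟩ E₃ ⟨-⟩ ⟨#⟩ 2 ⟨*⟩ E₂ ⟨*⟩ E₂) ⟨*⟩ (xx ⟨*⟩ zz)
         ⟨+⟩ (⟨#⟩ 3 ⟨*⟩ E₁ ⟨*⟩ E₃ ⟨-⟩ E₂ ⟨*⟩ E₂) ⟨*⟩ (xz ⟨*⟩ xz)
         ⟨+⟩ (⟨#⟩ 4 ⟨*⟩ E₁ ⟨*⟩ E₁ ⟨*⟩ E₃ ⟨-⟩ E₁ ⟨*⟩ E₂ ⟨*⟩ E₂ ⟨-⟩ ⟨#⟩ 3 ⟨*⟩ E₂ ⟨*⟩ E₃) ⟨*⟩ (xz ⟨*⟩ zz)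
         ⟨+⟩ (⟨#⟩ 4 ⟨*⟩ E₁ ⟨*⟩ E₂ ⟨*⟩ E₃ ⟨-⟩ E₂ ⟨*⟩ E₂ ⟨*⟩ E₂ ⟨-⟩ ⟨#⟩ 9 ⟨*⟩ E₃ ⟨*⟩ E₃) ⟨*⟩ (zz ⟨*⟩ zz)

    Z₃ : L 27 (D ℕ.+ D) S.Z₃ S′.Z₃
    Z₃ = yz ⟨*⟩ (yy ⟨+⟩ E₁ ⟨*⟩ xx ⟨+⟩ E₂ ⟨*⟩ xz ⟨+⟩ ⟨#⟩ 3 ⟨*⟩ E₃ ⟨*⟩ zz)
         ⟨+⟩ xy ⟨*⟩ (⟨#⟩ 3 ⟨*⟩ xx ⟨+⟩ E₁ ⟨*⟩ xz ⟨+⟩ E₂ ⟨*⟩ zz)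

-- Polynomial identities for the addition law over a commutative ring.

module RingAdditionLaw (R : CommutativeRing κ ℓ₁) where
  open CommutativeRing R
  open IntegerSolver R

  operations : Operations Carrier
  operations = record { _+_ = _+_ ; _*_ = _*_ ; _-_ = _-_ ; # = λ n → ⟦ + n ⟧ᶻ }

  syntax-operations : ∀ {n} → Operations _
  syntax-operations {n} = record { _+_ = _:+_ {n} ; _*_ = _:*_ ; _-_ = _:-_ ; # = λ i → con (+ i) }

  -- With the weights ignored, the derivation of homogeneity becomes a proof that the law respects
  -- equality.
  equality : GradedRelation operations operations ℓ₁
  equality = record
    { L     = λ _ _ → _≈_
    ; _⟨+⟩_ = +-cong
    ; _⟨-⟩_ = λ p q → +-cong p (-‿cong q)
    ; _⟨*⟩_ = *-cong
    ; ⟨#⟩   = λ _ → refl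
    }

  module Law = AdditionLaw operations
  module Cong {e₁ e₂ e₃ X₁ Y₁ Z₁ X₂ Y₂ Z₂} {e₁′ e₂′ e₃′ X₁′ Y₁′ Z₁′ X₂′ Y₂′ Z₂′} =
    AdditionLawRelated.Related equality {0} {0} {e₁} {e₂} {e₃} {X₁} {Y₁} {Z₁} {X₂} {Y₂} {Z₂}
      {e₁′} {e₂′} {e₃′} {X₁′} {Y₁′} {Z₁′} {X₂′} {Y₂′} {Z₂′}

  private
    module OnLine = AdditionOnLine operations

  -- With the coefficients of the curve eliminated by Vieta's formulas, this is a polynomial
  -- identity in independent variables, valid for x₁ = x₂ as well.
  line-X₃ : ∀ x₁ x₂ x₃ m n Z₁ Z₂ → let open OnLine x₁ x₂ x₃ m n Z₁ Z₂ in x₃ * Z₃ ≈ X₃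
  line-X₃ = solve 7 (λ x₁ x₂ x₃ m n Z₁ Z₂ →
    let open AdditionOnLine syntax-operations x₁ x₂ x₃ m n Z₁ Z₂
    in x₃ :* Z₃ := X₃) refl

  line-Y₃ : ∀ x₁ x₂ x₃ m n Z₁ Z₂ → let open OnLine x₁ x₂ x₃ m n Z₁ Z₂ in (- (m * x₃ + n)) * Z₃ ≈ Y₃
  line-Y₃ = solve 7 (λ x₁ x₂ x₃ m n Z₁ Z₂ →
    let open AdditionOnLine syntax-operations x₁ x₂ x₃ m n Z₁ Z₂
    in (:- (m :* x₃ :+ n)) :* Z₃ := Y₃) refl

  module _ (e₁ e₂ e₃ : Carrier) where
    -- `X₃` and `Z₃` are combinations of `xy` and `yz`, both of which vanish for opposite points.
    vertical-X₃ : ∀ x y Z₁ Z₂ → Law.X₃ e₁ e₂ e₃ (x * Z₁) ((- y) * Z₁) Z₁ (x * Z₂) (y * Z₂) Z₂ ≈ 0#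
    vertical-X₃ = solve 7 (λ e₁ e₂ e₃ x y Z₁ Z₂ →
      let open AdditionLaw syntax-operations
            e₁ e₂ e₃ (x :* Z₁) ((:- y) :* Z₁) Z₁ (x :* Z₂) (y :* Z₂) Z₂
      in X₃ := con +0) refl e₁ e₂ e₃

    vertical-Z₃ : ∀ x y Z₁ Z₂ → Law.Z₃ e₁ e₂ e₃ (x * Z₁) ((- y) * Z₁) Z₁ (x * Z₂) (y * Z₂) Z₂ ≈ 0#
    vertical-Z₃ = solve 7 (λ e₁ e₂ e₃ x y Z₁ Z₂ →
      let open AdditionLaw syntax-operations
            e₁ e₂ e₃ (x :* Z₁) ((:- y) :* Z₁) Z₁ (x :* Z₂) (y :* Z₂) Z₂
      in Z₃ := con +0) refl e₁ e₂ e₃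

    -- Only `xy`, `yy` and `yz` survive next to [0 : Y₁ : 0], so the second triple is merely scaled,
    -- by the same factor in all three coordinates.
    identityˡ-X₃ : ∀ Y₁ X₂ Y₂ Z₂ → Law.X₃ e₁ e₂ e₃ 0# Y₁ 0# X₂ Y₂ Z₂ ≈ X₂ * (Y₁ * Y₁ * Y₂)
    identityˡ-X₃ = solve 7 (λ e₁ e₂ e₃ Y₁ X₂ Y₂ Z₂ →
      let open AdditionLaw syntax-operations
            e₁ e₂ e₃ (con +0) Y₁ (con +0) X₂ Y₂ Z₂
      in X₃ := X₂ :* (Y₁ :* Y₁ :* Y₂)) refl e₁ e₂ e₃

    identityˡ-Y₃ : ∀ Y₁ X₂ Y₂ Z₂ → Law.Y₃ e₁ e₂ e₃ 0# Y₁ 0# X₂ Y₂ Z₂ ≈ Y₂ * (Y₁ * Y₁ * Y₂)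
    identityˡ-Y₃ = solve 7 (λ e₁ e₂ e₃ Y₁ X₂ Y₂ Z₂ →
      let open AdditionLaw syntax-operations
            e₁ e₂ e₃ (con +0) Y₁ (con +0) X₂ Y₂ Z₂
      in Y₃ := Y₂ :* (Y₁ :* Y₁ :* Y₂)) refl e₁ e₂ e₃

    identityˡ-Z₃ : ∀ Y₁ X₂ Y₂ Z₂ → Law.Z₃ e₁ e₂ e₃ 0# Y₁ 0# X₂ Y₂ Z₂ ≈ Z₂ * (Y₁ * Y₁ * Y₂)
    identityˡ-Z₃ = solve 7 (λ e₁ e₂ e₃ Y₁ X₂ Y₂ Z₂ →
      let open AdditionLaw syntax-operations
            e₁ e₂ e₃ (con +0) Y₁ (con +0) X₂ Y₂ Z₂
      in Z₃ := Z₂ :* (Y₁ :* Y₁ :* Y₂)) refl e₁ e₂ e₃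

    identityʳ-X₃ : ∀ X₁ Y₁ Z₁ Y₂ → Law.X₃ e₁ e₂ e₃ X₁ Y₁ Z₁ 0# Y₂ 0# ≈ X₁ * (Y₁ * Y₂ * Y₂)
    identityʳ-X₃ = solve 7 (λ e₁ e₂ e₃ X₁ Y₁ Z₁ Y₂ →
      let open AdditionLaw syntax-operations
            e₁ e₂ e₃ X₁ Y₁ Z₁ (con +0) Y₂ (con +0)
      in X₃ := X₁ :* (Y₁ :* Y₂ :* Y₂)) refl e₁ e₂ e₃

    identityʳ-Y₃ : ∀ X₁ Y₁ Z₁ Y₂ → Law.Y₃ e₁ e₂ e₃ X₁ Y₁ Z₁ 0# Y₂ 0# ≈ Y₁ * (Y₁ * Y₂ * Y₂)
    identityʳ-Y₃ = solve 7 (λ e₁ e₂ e₃ X₁ Y₁ Z₁ Y₂ →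
      let open AdditionLaw syntax-operations
            e₁ e₂ e₃ X₁ Y₁ Z₁ (con +0) Y₂ (con +0)
      in Y₃ := Y₁ :* (Y₁ :* Y₂ :* Y₂)) refl e₁ e₂ e₃

    identityʳ-Z₃ : ∀ X₁ Y₁ Z₁ Y₂ → Law.Z₃ e₁ e₂ e₃ X₁ Y₁ Z₁ 0# Y₂ 0# ≈ Z₁ * (Y₁ * Y₂ * Y₂)
    identityʳ-Z₃ = solve 7 (λ e₁ e₂ e₃ X₁ Y₁ Z₁ Y₂ →
      let open AdditionLaw syntax-operations
            e₁ e₂ e₃ X₁ Y₁ Z₁ (con +0) Y₂ (con +0)
      in Z₃ := Z₁ :* (Y₁ :* Y₂ :* Y₂)) refl e₁ e₂ e₃

  -- On the nodal cubic y²z = x²(x + z) the law is multiplicative in y + x and y - x.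
  nodal-Y₃+X₃ : ∀ X₁ Y₁ Z₁ X₂ Y₂ Z₂ → let open Law ⟦ + 1 ⟧ᶻ 0# 0# X₁ Y₁ Z₁ X₂ Y₂ Z₂ in
                Y₃ + X₃ ≈ (Y₁ * Y₂ - X₁ * X₂) * ((Y₁ + X₁) * (Y₂ + X₂))
  nodal-Y₃+X₃ = solve 6 (λ X₁ Y₁ Z₁ X₂ Y₂ Z₂ →
    let open AdditionLaw syntax-operations
          (con (+ 1)) (con +0) (con +0) X₁ Y₁ Z₁ X₂ Y₂ Z₂
    in Y₃ :+ X₃ := (Y₁ :* Y₂ :- X₁ :* X₂) :* ((Y₁ :+ X₁) :* (Y₂ :+ X₂))) refl

  nodal-Y₃-X₃ : ∀ X₁ Y₁ Z₁ X₂ Y₂ Z₂ → let open Law ⟦ + 1 ⟧ᶻ 0# 0# X₁ Y₁ Z₁ X₂ Y₂ Z₂ in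
                Y₃ - X₃ ≈ (Y₁ * Y₂ - X₁ * X₂) * ((Y₁ - X₁) * (Y₂ - X₂))
  nodal-Y₃-X₃ = solve 6 (λ X₁ Y₁ Z₁ X₂ Y₂ Z₂ →
    let open AdditionLaw syntax-operations
          (con (+ 1)) (con +0) (con +0) X₁ Y₁ Z₁ X₂ Y₂ Z₂
    in Y₃ :- X₃ := (Y₁ :* Y₂ :- X₁ :* X₂) :* ((Y₁ :- X₁) :* (Y₂ :- X₂))) refl

-- The addition law computes the sum of points of the curve.

module ProjectiveAddition
  (K : HeytingField κ ℓ₁ ℓ₂)
  (_#?_ : Decidable (HeytingField._#_ K))
  (E : EllipticCurve K)
  where

  open HeytingField K
  open EllipticCurve E
  open Points K _#?_ E

  R : CommutativeRing κ ℓ₁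
  R = record { isCommutativeRing = isCommutativeRing }

  open CommutativeRing R using (+-group)
  open IntegerSolver R
  open RingAdditionLaw R
  open SetoidReasoning setoid
  open GroupProperties +-group using (x∙y⁻¹≈ε⇒x≈y; x≈y⇒x∙y⁻¹≈ε)

  e₁ e₂ e₃ : Carrier
  e₁ = α + β + γ
  e₂ = α * β + β * γ + α * γ
  e₃ = α * β * γ

  -- [ X : Y : Z ] represents the point, or vanishes altogether.
  data Coordinates : Point → Carrier → Carrier → Carrier → Set (κ ⊔ ℓ₁) where
    ∞      : ∀ {X Y Z} → X ≈ 0# → Z ≈ 0# → Coordinates ∞ X Y Z
    affine : ∀ {x y X Y Z y²≈fx} → x * Z ≈ X → y * Z ≈ Y → Coordinates (affine x y y²≈fx) X Y Z

  Coordinates-∞ : ∀ {X Y Z} → Coordinates ∞ X Y Z → X ≈ 0#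
  Coordinates-∞ (∞ X≈0 _) = X≈0

  Coordinates-resp : ∀ {P P′ X Y Z} → P ≈ᴾ P′ → Coordinates P X Y Z → Coordinates P′ X Y Z
  Coordinates-resp ∞              (∞ X≈0 Z≈0)       = ∞ X≈0 Z≈0
  Coordinates-resp (affine x≈x′ y≈y′) (affine xZ≈X yZ≈Y) =
    affine (trans (*-congʳ (sym x≈x′)) xZ≈X) (trans (*-congʳ (sym y≈y′)) yZ≈Y)

  Coordinates-neg : ∀ {P X Y Z} → Coordinates P X Y Z → Coordinates (-ᴾ P) X (- Y) Z
  Coordinates-neg (∞ X≈0 Z≈0)       = ∞ X≈0 Z≈0
  Coordinates-neg (affine {y = y} {Z = Z} xZ≈X yZ≈Y) = affine xZ≈X
    (trans (solve 2 (λ y Z → (:- y) :* Z := :- (y :* Z)) refl y Z) (-‿cong yZ≈Y))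

  private
    *-cancelʳ-0 : ∀ {x y z} → y # z → x * (y - z) ≈ 0# → x ≈ 0#
    *-cancelʳ-0 {x} {y} {z} y#z e with w , _ , [y-z]w≈1 ← #⇒invertible y#z = begin
      x                   ≈⟨ *-identityʳ x ⟨
      x * 1#              ≈⟨ *-congˡ [y-z]w≈1 ⟨
      x * ((y - z) * w)   ≈⟨ *-assoc x (y - z) w ⟨
      x * (y - z) * w     ≈⟨ *-congʳ e ⟩
      0# * w              ≈⟨ zeroˡ w ⟩
      0#                  ∎

    slope-eq : ∀ {u x y} (x#y : x # y) → u * proj₁ (#⇒invertible x#y) * (x - y) ≈ u
    slope-eq {u} x#y with w , w[x-y]≈1 , _ ← #⇒invertible x#y =
      trans (*-assoc u w _) (trans (*-congˡ w[x-y]≈1) (*-identityʳ u))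

    sub-0 : ∀ {x y} → x ≈ 0# → y ≈ 0# → x - y ≈ 0#
    sub-0 x≈0 y≈0 = trans (+-cong x≈0 (-‿cong y≈0)) (-‿inverseʳ 0#)

    f-cong : ∀ {x x′} → x ≈ x′ → f x ≈ f x′
    f-cong e = *-cong (*-cong (+-congʳ e) (+-congʳ e)) (+-congʳ e)

  module Line {x₁ y₁ x₂ y₂ : Carrier} (m : Carrier) (onCurve : y₁ * y₁ ≈ f x₁) where
    n x₃ linear constant : Carrier
    n  = y₁ - m * x₁
    x₃ = thirdX m x₁ x₂
    -- f x - (m x + n)² - (x - x₁)(x - x₂)(x - x₃) = linear * x + constant
    linear   = e₂ - (x₁ * x₂ + x₁ * x₃ + x₂ * x₃ + ⟦ + 2 ⟧ᶻ * m * n)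
    constant = e₃ - (n * n - x₁ * x₂ * x₃)

    -- The product (x - x₁)(x - x₂)(x - x₃) vanishes at x₁, where the line has ordinate y₁.
    remainder₁ : linear * x₁ + constant ≈ f x₁ - y₁ * y₁
    remainder₁ = solve 7 (λ α β γ m x₁ y₁ x₂ →
      let n  = y₁ :- m :* x₁
          x₃ = m :* m :- (α :+ β :+ γ) :- x₁ :- x₂
      in (α :* β :+ β :* γ :+ α :* γ :- (x₁ :* x₂ :+ x₁ :* x₃ :+ x₂ :* x₃ :+ con (+ 2) :* m :* n)) :* x₁
           :+ (α :* β :* γ :- (n :* n :- x₁ :* x₂ :* x₃))
         := (x₁ :+ α) :* (x₁ :+ β) :* (x₁ :+ γ) :- y₁ :* y₁)
      refl α β γ m x₁ y₁ x₂

    remainder₂ : linear * x₂ + constant ≈ f x₂ - (m * x₂ + n) * (m * x₂ + n)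
    remainder₂ = solve 7 (λ α β γ m x₁ y₁ x₂ →
      let n  = y₁ :- m :* x₁
          x₃ = m :* m :- (α :+ β :+ γ) :- x₁ :- x₂
      in (α :* β :+ β :* γ :+ α :* γ :- (x₁ :* x₂ :+ x₁ :* x₃ :+ x₂ :* x₃ :+ con (+ 2) :* m :* n)) :* x₂
           :+ (α :* β :* γ :- (n :* n :- x₁ :* x₂ :* x₃))
         := (x₂ :+ α) :* (x₂ :+ β) :* (x₂ :+ γ) :- (m :* x₂ :+ n) :* (m :* x₂ :+ n))
      refl α β γ m x₁ y₁ x₂

    -- The same identity differentiated at x₁. It serves for tangents, where evaluation at x₂ = x₁
    -- gives no second condition.
    derivative : linear ≈ f′ x₁ - m * (y₁ - - y₁) - (x₁ - x₂) * (x₁ - x₃)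
    derivative = solve 7 (λ α β γ m x₁ y₁ x₂ →
      let n  = y₁ :- m :* x₁
          x₃ = m :* m :- (α :+ β :+ γ) :- x₁ :- x₂
      in α :* β :+ β :* γ :+ α :* γ :- (x₁ :* x₂ :+ x₁ :* x₃ :+ x₂ :* x₃ :+ con (+ 2) :* m :* n)
         := (x₁ :+ β) :* (x₁ :+ γ) :+ (x₁ :+ α) :* (x₁ :+ γ) :+ (x₁ :+ α) :* (x₁ :+ β)
            :- m :* (y₁ :- :- y₁) :- (x₁ :- x₂) :* (x₁ :- x₃))
      refl α β γ m x₁ y₁ x₂

    -- Once `linear` vanishes, so does `constant`, since x₁ is a zero of the remainder. The
    -- coefficients of the curve are then those of `AdditionOnLine`, and the identities on the line
    -- apply.
    sum-coordinates : linear ≈ 0# → y₂ ≈ m * x₂ + n → ∀ {X₁ Y₁ Z₁ X₂ Y₂ Z₂} →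
                      x₁ * Z₁ ≈ X₁ → y₁ * Z₁ ≈ Y₁ → x₂ * Z₂ ≈ X₂ → y₂ * Z₂ ≈ Y₂ →
                      ∀ {y²≈fx} → let open Law e₁ e₂ e₃ X₁ Y₁ Z₁ X₂ Y₂ Z₂ in
                      Coordinates (affine x₃ (reflectedY m x₁ y₁ x₃) y²≈fx) X₃ Y₃ Z₃
    sum-coordinates linear≈0 y₂≈ {X₁} {Y₁} {Z₁} {X₂} {Y₂} {Z₂} xZ₁ yZ₁ xZ₂ yZ₂ = affine
      (trans (*-congˡ C.Z₃) (trans (line-X₃ x₁ x₂ x₃ m n Z₁ Z₂) (sym C.X₃)))
      (trans (*-cong y₃≈ C.Z₃) (trans (line-Y₃ x₁ x₂ x₃ m n Z₁ Z₂) (sym C.Y₃)))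
      where
      constant≈0 : constant ≈ 0#
      constant≈0 = begin
        constant                                  ≈⟨ solve 3 (λ l x c → c := (l :* x :+ c) :- l :* x) refl linear x₁ constant ⟩
        (linear * x₁ + constant) - linear * x₁    ≈⟨ sub-0 (trans remainder₁ (x≈y⇒x∙y⁻¹≈ε (sym onCurve)))
                                                           (trans (*-congʳ linear≈0) (zeroˡ x₁)) ⟩
        0#                                        ∎
      y₁≈ : y₁ ≈ m * x₁ + n
      y₁≈ = solve 3 (λ y m x → y := m :* x :+ (y :- m :* x)) refl y₁ m x₁
      y₃≈ : reflectedY m x₁ y₁ x₃ ≈ - (m * x₃ + n)
      y₃≈ = solve 4 (λ m x₁ y₁ x₃ → m :* (x₁ :- x₃) :- y₁ := :- (m :* x₃ :+ (y₁ :- m :* x₁))) refl m x₁ y₁ x₃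
      module C = Cong
        (solve 4 (λ m e x₁ x₂ → e := m :* m :- (x₁ :+ x₂ :+ (m :* m :- e :- x₁ :- x₂))) refl m e₁ x₁ x₂)
        (x∙y⁻¹≈ε⇒x≈y _ _ linear≈0) (x∙y⁻¹≈ε⇒x≈y _ _ constant≈0)
        (sym xZ₁) (trans (sym yZ₁) (*-congʳ y₁≈)) (refl {Z₁})
        (sym xZ₂) (trans (sym yZ₂) (*-congʳ y₂≈)) (refl {Z₂})

  -- The cases are those of `_+ᴾ_`, all met by one formula. Exceptional pairs are included because
  -- `Coordinates` admits the zero triple; that the triple is nonzero is shown later, through the
  -- reduction.
  Coordinates-+ : ∀ {P Q X₁ Y₁ Z₁ X₂ Y₂ Z₂} → Coordinates P X₁ Y₁ Z₁ → Coordinates Q X₂ Y₂ Z₂ →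
                  let open Law e₁ e₂ e₃ X₁ Y₁ Z₁ X₂ Y₂ Z₂ in Coordinates (P +ᴾ Q) X₃ Y₃ Z₃
  Coordinates-+ {Y₁ = Y₁} {X₂ = X₂} {Y₂ = Y₂} {Z₂ = Z₂} (∞ X₁≈0 Z₁≈0) (∞ X₂≈0 Z₂≈0) =
    ∞ (trans C.X₃ (trans (identityˡ-X₃ e₁ e₂ e₃ Y₁ X₂ Y₂ Z₂) (trans (*-congʳ X₂≈0) (zeroˡ _))))
      (trans C.Z₃ (trans (identityˡ-Z₃ e₁ e₂ e₃ Y₁ X₂ Y₂ Z₂) (trans (*-congʳ Z₂≈0) (zeroˡ _))))
    where module C = Cong (refl {e₁}) (refl {e₂}) (refl {e₃}) X₁≈0 (refl {Y₁}) Z₁≈0 (refl {X₂}) (refl {Y₂}) (refl {Z₂})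
  Coordinates-+ {Y₁ = Y₁} {X₂ = X₂} {Y₂ = Y₂} {Z₂ = Z₂} (∞ X₁≈0 Z₁≈0) (affine {x} {y} xZ₂ yZ₂) = affine
    (trans (*-congˡ Z₃≈) (trans (sym (*-assoc x Z₂ _)) (trans (*-congʳ xZ₂)
      (sym (trans C.X₃ (identityˡ-X₃ e₁ e₂ e₃ Y₁ X₂ Y₂ Z₂))))))
    (trans (*-congˡ Z₃≈) (trans (sym (*-assoc y Z₂ _)) (trans (*-congʳ yZ₂)
      (sym (trans C.Y₃ (identityˡ-Y₃ e₁ e₂ e₃ Y₁ X₂ Y₂ Z₂))))))
    where
    module C = Cong (refl {e₁}) (refl {e₂}) (refl {e₃}) X₁≈0 (refl {Y₁}) Z₁≈0 (refl {X₂}) (refl {Y₂}) (refl {Z₂})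
    Z₃≈ = trans C.Z₃ (identityˡ-Z₃ e₁ e₂ e₃ Y₁ X₂ Y₂ Z₂)
  Coordinates-+ {X₁ = X₁} {Y₁} {Z₁} {Y₂ = Y₂} (affine {x} {y} xZ₁ yZ₁) (∞ X₂≈0 Z₂≈0) = affine
    (trans (*-congˡ Z₃≈) (trans (sym (*-assoc x Z₁ _)) (trans (*-congʳ xZ₁)
      (sym (trans C.X₃ (identityʳ-X₃ e₁ e₂ e₃ X₁ Y₁ Z₁ Y₂))))))
    (trans (*-congˡ Z₃≈) (trans (sym (*-assoc y Z₁ _)) (trans (*-congʳ yZ₁)
      (sym (trans C.Y₃ (identityʳ-Y₃ e₁ e₂ e₃ X₁ Y₁ Z₁ Y₂))))))
    where
    module C = Cong (refl {e₁}) (refl {e₂}) (refl {e₃}) (refl {X₁}) (refl {Y₁}) (refl {Z₁}) X₂≈0 (refl {Y₂}) Z₂≈0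
    Z₃≈ = trans C.Z₃ (identityʳ-Z₃ e₁ e₂ e₃ X₁ Y₁ Z₁ Y₂)
  Coordinates-+ {Z₁ = Z₁} {Z₂ = Z₂} (affine {x₁} {y₁} {y²≈fx = onCurve₁} xZ₁ yZ₁) (affine {x₂} {y₂} {y²≈fx = onCurve₂} xZ₂ yZ₂)
    with x₁ #? x₂ | y₁ #? (- y₂)
  ... | yes x₁#x₂ | _ = sum-coordinates (*-cancelʳ-0 x₁#x₂ linear*[x₁-x₂]≈0) y₂≈ xZ₁ yZ₁ xZ₂ yZ₂
    where
    m = chordSlope y₁ y₂ x₁#x₂
    open Line {x₂ = x₂} {y₂ = y₂} m onCurve₁
    y₂≈ : y₂ ≈ m * x₂ + n
    y₂≈ = begin
      y₂                       ≈⟨ solve 2 (λ y₁ y₂ → y₂ := y₁ :- (y₁ :- y₂)) refl y₁ y₂ ⟩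
      y₁ - (y₁ - y₂)           ≈⟨ +-congˡ (-‿cong (slope-eq x₁#x₂)) ⟨
      y₁ - m * (x₁ - x₂)       ≈⟨ solve 4 (λ y₁ m x₁ x₂ → y₁ :- m :* (x₁ :- x₂) := m :* x₂ :+ (y₁ :- m :* x₁)) refl y₁ m x₁ x₂ ⟩
      m * x₂ + n               ∎
    -- The remainder is a linear polynomial in x with zeros at both x₁ and x₂.
    linear*[x₁-x₂]≈0 : linear * (x₁ - x₂) ≈ 0#
    linear*[x₁-x₂]≈0 = begin
      linear * (x₁ - x₂)
        ≈⟨ solve 4 (λ l c x₁ x₂ → l :* (x₁ :- x₂) := (l :* x₁ :+ c) :- (l :* x₂ :+ c)) refl linear constant x₁ x₂ ⟩
      (linear * x₁ + constant) - (linear * x₂ + constant)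
        ≈⟨ sub-0 (trans remainder₁ (x≈y⇒x∙y⁻¹≈ε (sym onCurve₁)))
                 (trans remainder₂ (x≈y⇒x∙y⁻¹≈ε (trans (sym onCurve₂) (*-cong y₂≈ y₂≈)))) ⟩
      0# ∎
  ... | no ¬x₁#x₂ | yes y₁#-y₂ = sum-coordinates linear≈0 y₂≈ xZ₁ yZ₁ xZ₂ yZ₂
    where
    m = tangentSlope x₁ y₁#-y₂
    open Line {x₂ = x₂} {y₂ = y₂} m onCurve₁
    x₁≈x₂ : x₁ ≈ x₂
    x₁≈x₂ = proj₁ (tight x₁ x₂) ¬x₁#x₂
    y₁≈y₂ : y₁ ≈ y₂
    -- The ordinates have equal squares, and they are not opposite.
    y₁≈y₂ = x∙y⁻¹≈ε⇒x≈y _ _ (*-cancelʳ-0 y₁#-y₂ (begin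
      (y₁ - y₂) * (y₁ - - y₂)   ≈⟨ solve 2 (λ y₁ y₂ → (y₁ :- y₂) :* (y₁ :- :- y₂) := y₁ :* y₁ :- y₂ :* y₂) refl y₁ y₂ ⟩
      y₁ * y₁ - y₂ * y₂         ≈⟨ x≈y⇒x∙y⁻¹≈ε (trans onCurve₁ (trans (f-cong x₁≈x₂) (sym onCurve₂))) ⟩
      0#                        ∎))
    y₂≈ : y₂ ≈ m * x₂ + n
    y₂≈ = begin
      y₂            ≈⟨ y₁≈y₂ ⟨
      y₁            ≈⟨ solve 3 (λ y m x → y := m :* x :+ (y :- m :* x)) refl y₁ m x₁ ⟩
      m * x₁ + n    ≈⟨ +-congʳ (*-congˡ x₁≈x₂) ⟩
      m * x₂ + n    ∎
    linear≈0 : linear ≈ 0#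
    -- The tangent slope m satisfies 2my₁ = f′(x₁), and x₁ - x₂ vanishes.
    linear≈0 = trans derivative (sub-0
      (x≈y⇒x∙y⁻¹≈ε (sym (trans (*-congˡ (+-congˡ (-‿cong (-‿cong y₁≈y₂)))) (slope-eq y₁#-y₂))))
      (trans (*-congʳ (x≈y⇒x∙y⁻¹≈ε x₁≈x₂)) (zeroˡ _)))
  ... | no ¬x₁#x₂ | no ¬y₁#-y₂ = ∞
    (trans C.X₃ (vertical-X₃ e₁ e₂ e₃ x₂ y₂ Z₁ Z₂))
    (trans C.Z₃ (vertical-Z₃ e₁ e₂ e₃ x₂ y₂ Z₁ Z₂))
    where
    module C = Cong (refl {e₁}) (refl {e₂}) (refl {e₃})
      (trans (sym xZ₁) (*-congʳ (proj₁ (tight x₁ x₂) ¬x₁#x₂))) (trans (sym yZ₁) (*-congʳ (proj₁ (tight y₁ (- y₂)) ¬y₁#-y₂))) (refl {Z₁})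
      (sym xZ₂) (sym yZ₂) (refl {Z₂})

-- Leading coefficients of polynomials.

-- p = r kⁿ + lower terms, where r may be zero.
data Top : ℕ → Polynomial.ℚ[k] → ℚ → Set where
  zero  : ∀ {n} → Top n [] 0ℚ
  const : ∀ {r} → Top 0 (r ∷ []) r
  shift : ∀ {n p r s} → Top n p r → Top (suc n) (s ∷ p) r

module _ where
  open Polynomial

  Top-unique-0 : ∀ {n p r} → Top n p r → p ≈ 0ₚ → r ≡ 0ℚ
  Top-unique-0 zero      _   = ≡.refl
  Top-unique-0 const     p≈0 = at p≈0 0
  Top-unique-0 (shift t) p≈0 = Top-unique-0 t (coeffwise λ i → at p≈0 (suc i))

  -- Used for products: in (s + kp)q the summand sq lies below the top degree.
  Top-raise : ∀ {n p r} → Top n p r → ∀ m → Top (suc m ℕ.+ n) p 0ℚ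
  Top-raise zero      m = zero
  Top-raise const     m rewrite ℕ.+-identityʳ m = shift zero
  Top-raise (shift {n} t) m rewrite ℕ.+-suc m n = shift (Top-raise t m)

  Top-+ : ∀ {n p q r s} → Top n p r → Top n q s → Top n (p + q) (r ℚ.+ s)
  Top-+ {s = s} zero t = ≡.subst (Top _ _) (≡.sym (ℚ.+-identityˡ s)) t
  Top-+ const zero = ≡.subst (Top _ _) (≡.sym (ℚ.+-identityʳ _)) const
  Top-+ (shift {r = r} t) zero = ≡.subst (Top _ _) (≡.sym (ℚ.+-identityʳ r)) (shift t)
  Top-+ const const = const
  Top-+ (shift t) (shift u) = shift (Top-+ t u)

  Top-neg : ∀ {n p r} → Top n p r → Top n (- p) (ℚ.- r)
  Top-neg zero      = zero
  Top-neg const     = const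
  Top-neg (shift t) = shift (Top-neg t)

  Top-· : ∀ {n p r} s → Top n p r → Top n (s · p) (s ℚ.* r)
  Top-· s zero      = ≡.subst (Top _ _) (≡.sym (ℚ.*-zeroʳ s)) zero
  Top-· s const     = const
  Top-· s (shift t) = shift (Top-· s t)

  Top-* : ∀ {m n p q r s} → Top m p r → Top n q s → Top (m ℕ.+ n) (p * q) (r ℚ.* s)
  Top-* {s = s} zero u = ≡.subst (Top _ _) (≡.sym (ℚ.*-zeroˡ s)) zero
  -- Multiplication by a one-element list leaves the extra summand `0ℚ ∷ []`, which `0-top` accounts
  -- for.
  Top-* {n = n} (const {r}) u = ≡.subst (Top _ _) (ℚ.+-identityʳ _) (Top-+ (Top-· r u) (0-top n))
    where
    0-top : ∀ n → Top n (0ℚ ∷ []) 0ℚ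
    0-top zero    = const
    0-top (suc n) = shift zero
  Top-* {m = suc m} (shift {s = s} t) u =
    ≡.subst (Top _ _) (ℚ.+-identityˡ _) (Top-+ (Top-raise (Top-· s u) m) (shift (Top-* t u)))

top? : ∀ n p r → Dec (Top n p r)
top? n       []          r = map′ (λ { ≡.refl → zero }) (λ { zero → ≡.refl }) (r ℚ.≟ 0ℚ)
top? zero    (s ∷ [])    r = map′ (λ { ≡.refl → const }) (λ { const → ≡.refl }) (r ℚ.≟ s)
top? zero    (s ∷ _ ∷ _) r = no λ ()
top? (suc n) (s ∷ p)     r = map′ shift (λ { (shift t) → t }) (top? n p r)

-- Natural numbers inside ℚ.

module ℚ-Numerals where
  open CommutativeRing ℚ.+-*-commutativeRing using (+-group; semiring)
  open GroupProperties +-group using (∙-cancelˡ; x∙y⁻¹≈ε⇒x≈y; x≈y⇒x∙y⁻¹≈ε) public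
  open SemiringMult semiring using (×-homo-+; ×1-homo-*)
  open IntegerSolver ℚ.+-*-commutativeRing public
  open HeytingProperties ℚ.heytingCommutativeRing using (x#0y#0→xy#0)

  *≢0 : ∀ {x y} → x ≢ 0ℚ → y ≢ 0ℚ → x ℚ.* y ≢ 0ℚ
  *≢0 = x#0y#0→xy#0

  *-cancelʳ-≢0 : ∀ {x y z} → z ≢ 0ℚ → x ℚ.* z ≡ y ℚ.* z → x ≡ y
  *-cancelʳ-≢0 {x} {y} {z} z≢0 e with x ℚ.- y ℚ.≟ 0ℚ
  ... | yes x-y≡0 = x∙y⁻¹≈ε⇒x≈y x y x-y≡0
  ... | no  x-y≢0 = contradiction
    (≡.trans (solve 3 (λ x y z → (x :- y) :* z := x :* z :- y :* z) ≡.refl x y z) (x≈y⇒x∙y⁻¹≈ε e))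
    (*≢0 x-y≢0 z≢0)

  ⟦_⟧ : ℕ → ℚ
  ⟦ n ⟧ = ⟦ + n ⟧ᶻ

  ⟦⟧-+ : ∀ m n → ⟦ m ℕ.+ n ⟧ ≡ ⟦ m ⟧ ℚ.+ ⟦ n ⟧
  ⟦⟧-+ = ×-homo-+ 1ℚ

  ⟦⟧-* : ∀ m n → ⟦ m ℕ.* n ⟧ ≡ ⟦ m ⟧ ℚ.* ⟦ n ⟧
  ⟦⟧-* = ×1-homo-*

  0≤⟦⟧ : ∀ n → 0ℚ ℚ.≤ ⟦ n ⟧
  0≤⟦⟧ zero    = ℚ.≤-refl
  0≤⟦⟧ (suc n) = ℚ.+-mono-≤ {0ℚ} {1ℚ} (from-yes (0ℚ ℚ.≤? 1ℚ)) (0≤⟦⟧ n)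

  ⟦suc⟧≢0 : ∀ n → ⟦ suc n ⟧ ≢ 0ℚ
  ⟦suc⟧≢0 n e = ℚ.<⇒≢ (ℚ.+-mono-<-≤ {0ℚ} {1ℚ} (from-yes (0ℚ ℚ.<? 1ℚ)) (0≤⟦⟧ n)) (≡.sym e)

  ⟦⟧-injective : ∀ {m n} → ⟦ m ⟧ ≡ ⟦ n ⟧ → m ≡ n
  ⟦⟧-injective {zero}  {zero}  _ = ≡.refl
  ⟦⟧-injective {zero}  {suc n} e = contradiction (≡.sym e) (⟦suc⟧≢0 n)
  ⟦⟧-injective {suc m} {zero}  e = contradiction e (⟦suc⟧≢0 m)
  ⟦⟧-injective {suc m} {suc n} e = ≡.cong suc (⟦⟧-injective (∙-cancelˡ 1ℚ _ _ e))

  ⟦⟧≢0 : ∀ n {{_ : NonZero n}} → ⟦ n ⟧ ≢ 0ℚ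
  ⟦⟧≢0 (suc n) = ⟦suc⟧≢0 n

open ℚ-Numerals

-- Multiplicativity on the nodal cubic.

module NodalCubic
  (X₁ Y₁ Z₁ X₂ Y₂ Z₂ : ℚ) (p₁ q₁ p₂ q₂ : ℕ)
  (smooth₁ : Y₁ ℚ.+ X₁ ≢ 0ℚ) (ratio₁ : ⟦ p₁ ⟧ ℚ.* (Y₁ ℚ.+ X₁) ≡ ⟦ q₁ ⟧ ℚ.* (Y₁ ℚ.- X₁))
  (smooth₂ : Y₂ ℚ.+ X₂ ≢ 0ℚ) (ratio₂ : ⟦ p₂ ⟧ ℚ.* (Y₂ ℚ.+ X₂) ≡ ⟦ q₂ ⟧ ℚ.* (Y₂ ℚ.- X₂))
  where

  open RingAdditionLaw ℚ.+-*-commutativeRing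
  open Law ⟦ 1 ⟧ 0ℚ 0ℚ X₁ Y₁ Z₁ X₂ Y₂ Z₂
  open ≡.≡-Reasoning

  private
    A₁ = Y₁ ℚ.+ X₁
    A₂ = Y₂ ℚ.+ X₂
    B₁ = Y₁ ℚ.- X₁
    B₂ = Y₂ ℚ.- X₂
    common = Y₁ ℚ.* Y₂ ℚ.- X₁ ℚ.* X₂

    regroup : ∀ s t u v → s ℚ.* t ℚ.* (common ℚ.* (u ℚ.* v)) ≡ common ℚ.* ((s ℚ.* u) ℚ.* (t ℚ.* v))
    regroup = solve 5 (λ c s t u v → s :* t :* (c :* (u :* v)) := c :* ((s :* u) :* (t :* v))) ≡.refl common

    -- Since 2(Y₁Y₂ - X₁X₂) = A₁B₂ + A₂B₁ and u = B/A, the factor `common` is A₁A₂(u₁ + u₂)/2. It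
    -- can vanish only for u₁ = -u₂.
    cross-sum : ⟦ 2 ⟧ ℚ.* ⟦ q₁ ⟧ ℚ.* ⟦ q₂ ⟧ ℚ.* common ≡ ⟦ p₂ ℕ.* q₁ ℕ.+ p₁ ℕ.* q₂ ⟧ ℚ.* (A₁ ℚ.* A₂)
    cross-sum = begin
      ⟦ 2 ⟧ ℚ.* ⟦ q₁ ⟧ ℚ.* ⟦ q₂ ⟧ ℚ.* common
        ≡⟨ solve 6 (λ q₁ q₂ X₁ Y₁ X₂ Y₂ → con (+ 2) :* q₁ :* q₂ :* (Y₁ :* Y₂ :- X₁ :* X₂)
             := q₁ :* (Y₁ :+ X₁) :* (q₂ :* (Y₂ :- X₂)) :+ q₂ :* (Y₂ :+ X₂) :* (q₁ :* (Y₁ :- X₁)))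
             ≡.refl ⟦ q₁ ⟧ ⟦ q₂ ⟧ X₁ Y₁ X₂ Y₂ ⟩
      ⟦ q₁ ⟧ ℚ.* A₁ ℚ.* (⟦ q₂ ⟧ ℚ.* B₂) ℚ.+ ⟦ q₂ ⟧ ℚ.* A₂ ℚ.* (⟦ q₁ ⟧ ℚ.* B₁)
        ≡⟨ ≡.cong₂ ℚ._+_ (≡.cong (⟦ q₁ ⟧ ℚ.* A₁ ℚ.*_) (≡.sym ratio₂)) (≡.cong (⟦ q₂ ⟧ ℚ.* A₂ ℚ.*_) (≡.sym ratio₁)) ⟩
      ⟦ q₁ ⟧ ℚ.* A₁ ℚ.* (⟦ p₂ ⟧ ℚ.* A₂) ℚ.+ ⟦ q₂ ⟧ ℚ.* A₂ ℚ.* (⟦ p₁ ⟧ ℚ.* A₁)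
        ≡⟨ solve 6 (λ p₁ q₁ p₂ q₂ A₁ A₂ → q₁ :* A₁ :* (p₂ :* A₂) :+ q₂ :* A₂ :* (p₁ :* A₁)
             := (p₂ :* q₁ :+ p₁ :* q₂) :* (A₁ :* A₂)) ≡.refl ⟦ p₁ ⟧ ⟦ q₁ ⟧ ⟦ p₂ ⟧ ⟦ q₂ ⟧ A₁ A₂ ⟩
      (⟦ p₂ ⟧ ℚ.* ⟦ q₁ ⟧ ℚ.+ ⟦ p₁ ⟧ ℚ.* ⟦ q₂ ⟧) ℚ.* (A₁ ℚ.* A₂)
        ≡⟨ ≡.cong (ℚ._* (A₁ ℚ.* A₂)) (≡.trans (⟦⟧-+ (p₂ ℕ.* q₁) (p₁ ℕ.* q₂)) (≡.cong₂ ℚ._+_ (⟦⟧-* p₂ q₁) (⟦⟧-* p₁ q₂))) ⟨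
      ⟦ p₂ ℕ.* q₁ ℕ.+ p₁ ℕ.* q₂ ⟧ ℚ.* (A₁ ℚ.* A₂) ∎

  -- `Y₃ + X₃` and `Y₃ - X₃` are A₁A₂ and B₁B₂ times the same factor `common`, whence u₃ = u₁u₂.
  ratio₃ : ⟦ p₁ ℕ.* p₂ ⟧ ℚ.* (Y₃ ℚ.+ X₃) ≡ ⟦ q₁ ℕ.* q₂ ⟧ ℚ.* (Y₃ ℚ.- X₃)
  ratio₃ = begin
    ⟦ p₁ ℕ.* p₂ ⟧ ℚ.* (Y₃ ℚ.+ X₃)
      ≡⟨ ≡.cong₂ ℚ._*_ (⟦⟧-* p₁ p₂) (nodal-Y₃+X₃ X₁ Y₁ Z₁ X₂ Y₂ Z₂) ⟩
    ⟦ p₁ ⟧ ℚ.* ⟦ p₂ ⟧ ℚ.* (common ℚ.* (A₁ ℚ.* A₂))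
      ≡⟨ regroup ⟦ p₁ ⟧ ⟦ p₂ ⟧ A₁ A₂ ⟩
    common ℚ.* ((⟦ p₁ ⟧ ℚ.* A₁) ℚ.* (⟦ p₂ ⟧ ℚ.* A₂))
      ≡⟨ ≡.cong (common ℚ.*_) (≡.cong₂ ℚ._*_ ratio₁ ratio₂) ⟩
    common ℚ.* ((⟦ q₁ ⟧ ℚ.* B₁) ℚ.* (⟦ q₂ ⟧ ℚ.* B₂))
      ≡⟨ regroup ⟦ q₁ ⟧ ⟦ q₂ ⟧ B₁ B₂ ⟨
    ⟦ q₁ ⟧ ℚ.* ⟦ q₂ ⟧ ℚ.* (common ℚ.* (B₁ ℚ.* B₂))
      ≡⟨ ≡.cong₂ ℚ._*_ (⟦⟧-* q₁ q₂) (nodal-Y₃-X₃ X₁ Y₁ Z₁ X₂ Y₂ Z₂) ⟨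
    ⟦ q₁ ℕ.* q₂ ⟧ ℚ.* (Y₃ ℚ.- X₃) ∎

  -- This is where positivity enters: p₁/q₁ ≠ -p₂/q₂.
  smooth₃ : {{_ : NonZero p₁}} {{_ : NonZero q₁}} {{_ : NonZero p₂}} {{_ : NonZero q₂}} → Y₃ ℚ.+ X₃ ≢ 0ℚ
  smooth₃ = ≡.subst (_≢ 0ℚ) (≡.sym (nodal-Y₃+X₃ X₁ Y₁ Z₁ X₂ Y₂ Z₂)) (*≢0 common≢0 (*≢0 smooth₁ smooth₂))
    where
    sum≢0 : NonZero (p₂ ℕ.* q₁ ℕ.+ p₁ ℕ.* q₂)
    sum≢0 = ℕ.≢-nonZero λ e → ℕ.≢-nonZero⁻¹ (p₂ ℕ.* q₁) {{ℕ.m*n≢0 p₂ q₁}} (ℕ.m+n≡0⇒m≡0 (p₂ ℕ.* q₁) e)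
    common≢0 : common ≢ 0ℚ
    common≢0 common≡0 = *≢0 (⟦⟧≢0 _ {{sum≢0}}) (*≢0 smooth₁ smooth₂)
      (≡.trans (≡.sym cross-sum) (≡.trans (≡.cong (⟦ 2 ⟧ ℚ.* ⟦ q₁ ⟧ ℚ.* ⟦ q₂ ⟧ ℚ.*_) common≡0) (ℚ.*-zeroʳ (⟦ 2 ⟧ ℚ.* ⟦ q₁ ⟧ ℚ.* ⟦ q₂ ⟧))))

-- Reduction of points to the nodal cubic.

module NodalReduction
  {κ ℓ₁ ℓ₂ ℓ₃} (K : HeytingField κ ℓ₁ ℓ₂)
  (_#?_ : Decidable (HeytingField._#_ K))
  (E : EllipticCurve K)
  (G : GradedRelation (RingAdditionLaw.operations (ProjectiveAddition.R K _#?_ E))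
                      (RingAdditionLaw.operations ℚ.+-*-commutativeRing) ℓ₃)
  where

  open HeytingField K
  open ProjectiveAddition K _#?_ E
  open Points K _#?_ E
  open GradedRelation G

  module Reduce
    (L-0     : ∀ {w d x r} → L w d x r → x ≈ 0# → r ≡ 0ℚ)
    (L-neg   : ∀ {w d x r} → L w d x r → L w d (- x) (ℚ.- r))
    (L-shift : ∀ w v d {x r} → L (w ℕ.+ v) d x r → L w (v ℕ.+ d) x r)
    (e₁-top  : L 6 0 e₁ ⟦ 1 ⟧)
    (e₂-top  : L 12 0 e₂ 0ℚ)
    (e₃-top  : L 18 0 e₃ 0ℚ)
    where

    -- The point reduces to a smooth point of the nodal cubic y² = x²(x + 1), whose
    -- image (y - x)/(y + x) in the multiplicative group is p/q > 0.
    record Reduction (P : Point) (p q : ℕ) : Set (κ ⊔ ℓ₁ ⊔ ℓ₃) where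
      field
        {X Y Z}     : Carrier
        coordinates : Coordinates P X Y Z
        weight      : ℕ
        {X₀ Y₀ Z₀}  : ℚ
        X-top       : L 6 weight X X₀
        Y-top       : L 9 weight Y Y₀
        Z-top       : L 0 weight Z Z₀
        smooth      : Y₀ ℚ.+ X₀ ≢ 0ℚ
        ratio       : ⟦ p ⟧ ℚ.* (Y₀ ℚ.+ X₀) ≡ ⟦ q ⟧ ℚ.* (Y₀ ℚ.- X₀)
        {{p≢0}}     : NonZero p
        {{q≢0}}     : NonZero q

    Reduction-resp : ∀ {P Q p q} → P ≈ᴾ Q → Reduction P p q → Reduction Q p q
    Reduction-resp P≈Q r = record
      { coordinates = Coordinates-resp P≈Q coordinates ; weight = weight
      ; X-top = X-top ; Y-top = Y-top ; Z-top = Z-top ; smooth = smooth ; ratio = ratio }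
      where open Reduction r

    -- Coordinates of ∞ have X = 0, hence X₀ = 0 and u = 1.
    Reduction-∞-unique : ∀ {p q} → Reduction ∞ p q → p ≡ q
    Reduction-∞-unique {p} {q} r =
      ⟦⟧-injective (*-cancelʳ-≢0 smooth (≡.trans ratio (≡.cong (⟦ q ⟧ ℚ.*_) Y₀-X₀≡Y₀+X₀)))
      where
      open Reduction r
      Y₀-X₀≡Y₀+X₀ : Y₀ ℚ.- X₀ ≡ Y₀ ℚ.+ X₀
      Y₀-X₀≡Y₀+X₀ = ≡.subst (λ x → Y₀ ℚ.- x ≡ Y₀ ℚ.+ x) (≡.sym (L-0 X-top (Coordinates-∞ coordinates))) ≡.refl

    -- A change of sign of Y exchanges Y + X and Y - X up to sign, so u becomes 1/u.
    Reduction-neg : ∀ {P p q} → Reduction P p q → Reduction (-ᴾ P) q p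
    Reduction-neg {p = p} {q} r = record
      { coordinates = Coordinates-neg coordinates
      ; weight = weight
      ; X-top  = X-top
      ; Y-top  = L-neg Y-top
      ; Z-top  = Z-top
      -- Y₀ - X₀ is nonzero because p and Y₀ + X₀ are.
      ; smooth = λ -Y₀+X₀≡0 → *≢0 (⟦⟧≢0 p) smooth (≡.trans ratio (≡.trans
          (solve 3 (λ q X Y → q :* (Y :- X) := :- (q :* (:- Y :+ X))) ≡.refl ⟦ q ⟧ X₀ Y₀)
          (≡.cong ℚ.-_ (≡.trans (≡.cong (⟦ q ⟧ ℚ.*_) -Y₀+X₀≡0) (ℚ.*-zeroʳ ⟦ q ⟧)))))
      ; ratio  = begin
          ⟦ q ⟧ ℚ.* (ℚ.- Y₀ ℚ.+ X₀)     ≡⟨ solve 3 (λ q X Y → q :* (:- Y :+ X) := :- (q :* (Y :- X))) ≡.refl ⟦ q ⟧ X₀ Y₀ ⟩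
          ℚ.- (⟦ q ⟧ ℚ.* (Y₀ ℚ.- X₀))   ≡⟨ ≡.cong ℚ.-_ ratio ⟨
          ℚ.- (⟦ p ⟧ ℚ.* (Y₀ ℚ.+ X₀))   ≡⟨ solve 3 (λ p X Y → :- (p :* (Y :+ X)) := p :* (:- Y :- X)) ≡.refl ⟦ p ⟧ X₀ Y₀ ⟩
          ⟦ p ⟧ ℚ.* (ℚ.- Y₀ ℚ.- X₀)     ∎
      }
      where
      open Reduction r
      open ≡.≡-Reasoning

    Reduction-+ : ∀ {P Q p₁ q₁ p₂ q₂} → Reduction P p₁ q₁ → Reduction Q p₂ q₂ →
                  Reduction (P +ᴾ Q) (p₁ ℕ.* p₂) (q₁ ℕ.* q₂)
    Reduction-+ {p₁ = p₁} {q₁} {p₂} {q₂} r₁ r₂ = record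
      { coordinates = Coordinates-+ M.coordinates N.coordinates
      -- The excess 27 of the weights 33, 36, 27 over 6, 9, 0 is absorbed into the shift.
      ; weight = 27 ℕ.+ ((M.weight ℕ.+ N.weight) ℕ.+ (M.weight ℕ.+ N.weight))
      ; X-top  = L-shift 6 27 _ S.X₃
      ; Y-top  = L-shift 9 27 _ S.Y₃
      ; Z-top  = L-shift 0 27 _ S.Z₃
      ; smooth = smooth₃
      ; ratio  = ratio₃
      ; p≢0    = ℕ.m*n≢0 p₁ p₂
      ; q≢0    = ℕ.m*n≢0 q₁ q₂
      }
      where
      module M = Reduction r₁
      module N = Reduction r₂
      module S = AdditionLawRelated.Related G {M.weight} {N.weight} e₁-top e₂-top e₃-top
        M.X-top M.Y-top M.Z-top N.X-top N.Y-top N.Z-top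
      open NodalCubic M.X₀ M.Y₀ M.Z₀ N.X₀ N.Y₀ N.Z₀ p₁ q₁ p₂ q₂ M.smooth M.ratio N.smooth N.ratio
      instance
        p₁≢0 = M.p≢0
        q₁≢0 = M.q≢0
        p₂≢0 = N.p≢0
        q₂≢0 = N.q≢0

-- Multiplicative independence of 3 and 9/5.

-- The numerator of (p/q)^z, without cancellation.
power : ℕ → ℕ → ℤ → ℕ
power p q (+ n)    = p ℕ.^ n
power p q -[1+ n ] = q ℕ.^ suc n

module _ {r : ℕ} (r-prime : Prime r) where
  ∤-* : ∀ {m n} → r ∤ m → r ∤ n → r ∤ m ℕ.* n
  ∤-* {m} {n} r∤m r∤n r∣mn = [ r∤m , r∤n ]′ (euclidsLemma m n r-prime r∣mn)

  ∤-1 : r ∤ 1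
  ∤-1 r∣1 = contradiction (≡.subst Prime (∣1⇒≡1 r∣1) r-prime) ¬prime[1]

  ∤-^ : ∀ {m} → r ∤ m → ∀ n → r ∤ m ℕ.^ n
  ∤-^ r∤m zero    = ∤-1
  ∤-^ r∤m (suc n) = ∤-* r∤m (∤-^ r∤m n)

  ∤-power : ∀ {p q} → r ∤ p → r ∤ q → ∀ z → r ∤ power p q z
  ∤-power r∤p r∤q (+ n)    = ∤-^ r∤p n
  ∤-power r∤p r∤q -[1+ n ] = ∤-^ r∤q (suc n)

private
  3-prime = from-yes (prime? 3)
  5-prime = from-yes (prime? 5)
  5∤3 = from-no (5 ∣? 3)
  5∤9 = from-no (5 ∣? 9)

-- The prime 5 occurs in 9/5 only, which forces n = 0; then the prime 3 forces m = 0.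
3-and-9/5-independent : ∀ m n → power 3 1 m ℕ.* (power 9 5 n ℕ.* 1) ≡ power 1 3 m ℕ.* (power 5 9 n ℕ.* 1) →
                        m ≡ +0 × n ≡ +0
3-and-9/5-independent m (+ suc n) e = contradiction
  (≡.subst (5 ∣_) (≡.sym e) (∣n⇒∣m*n (power 1 3 m) (∣m⇒∣m*n 1 (m∣m*n (5 ℕ.^ n)))))
  (∤-* 5-prime (∤-power 5-prime 5∤3 (∤-1 5-prime) m) (∤-* 5-prime (∤-^ 5-prime 5∤9 (suc n)) (∤-1 5-prime)))
3-and-9/5-independent m -[1+ n ] e = contradiction
  (≡.subst (5 ∣_) e (∣n⇒∣m*n (power 3 1 m) (∣m⇒∣m*n 1 (m∣m*n (5 ℕ.^ n)))))
  (∤-* 5-prime (∤-power 5-prime (∤-1 5-prime) 5∤3 m) (∤-* 5-prime (∤-^ 5-prime 5∤9 (suc n)) (∤-1 5-prime)))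
3-and-9/5-independent (+ zero) (+ zero) _ = ≡.refl , ≡.refl
3-and-9/5-independent (+ suc m) (+ zero) e = contradiction
  (≡.subst (3 ∣_) e (∣m⇒∣m*n 1 (m∣m*n (3 ℕ.^ m))))
  (∤-* 3-prime (∤-^ 3-prime (∤-1 3-prime) (suc m)) (∤-1 3-prime))
3-and-9/5-independent -[1+ m ] (+ zero) e = contradiction
  (≡.subst (3 ∣_) (≡.sym e) (∣m⇒∣m*n 1 (m∣m*n (3 ℕ.^ m))))
  (∤-* 3-prime (∤-^ 3-prime (∤-1 3-prime) (suc m)) (∤-1 3-prime))

-- Reduction of the curve at k = ∞.

module Infinity where
  open HeytingField ℚ⟨k⟩ hiding (zero)
  open ℚ⟨k⟩ using (ι; cross; cross-eq)
  open ProjectiveAddition ℚ⟨k⟩ _#?_ E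
  open Points ℚ⟨k⟩ _#?_ E

  private
    module P = CommutativeRing Polynomial.commutativeRing
    module PS = IntegerSolver Polynomial.commutativeRing

  ι-+ : ∀ p q → ι p + ι q ≈ ι (p P.+ q)
  ι-+ p q = cross (PS.solve 3 (λ p q o → (p PS.:* o PS.:+ q PS.:* o) PS.:* o PS.:= (p PS.:+ q) PS.:* (o PS.:* o)) P.refl p q P.1#)

  ι-* : ∀ p q → ι p * ι q ≈ ι (p P.* q)
  ι-* p q = cross (P.*-congˡ {p P.* q} (P.sym (P.*-identityˡ P.1#)))

  ι-0 : ∀ {p} → ι p ≈ 0# → p P.≈ P.0#
  ι-0 {p} e = P.trans (P.sym (P.*-identityʳ p)) (P.trans (cross-eq e) (P.zeroˡ P.1#))

  -- r is the value of x/kⁿ at k = ∞. Denominators of a point are moved into its Z-coordinate, so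
  -- degrees of polynomials take the place of a valuation on ℚ(k).
  record LeadingTerm (n : ℕ) (x : Carrier) (r : ℚ) : Set where
    constructor leading
    field
      {poly}  : Polynomial.ℚ[k]
      x≈ιpoly : x ≈ ι poly
      top     : Top n poly r

  LeadingTerm-0 : ∀ {n x r} → LeadingTerm n x r → x ≈ 0# → r ≡ 0ℚ
  LeadingTerm-0 (leading e t) x≈0 = Top-unique-0 t (ι-0 (trans (sym e) x≈0))

  LeadingTerm-+ : ∀ {n x y r s} → LeadingTerm n x r → LeadingTerm n y s → LeadingTerm n (x + y) (r ℚ.+ s)
  LeadingTerm-+ (leading {p} e t) (leading {q} f u) = leading (trans (+-cong e f) (ι-+ p q)) (Top-+ t u)

  LeadingTerm-neg : ∀ {n x r} → LeadingTerm n x r → LeadingTerm n (- x) (ℚ.- r)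
  LeadingTerm-neg (leading e t) = leading (-‿cong e) (Top-neg t)

  LeadingTerm-* : ∀ {m n x y r s} → LeadingTerm m x r → LeadingTerm n y s → LeadingTerm (m ℕ.+ n) (x * y) (r ℚ.* s)
  LeadingTerm-* (leading {p} e t) (leading {q} f u) = leading (trans (*-cong e f) (ι-* p q)) (Top-* t u)

  LeadingTerm-# : ∀ n → LeadingTerm 0 (IntegerSolver.⟦_⟧ᶻ R (+ n)) (IntegerSolver.⟦_⟧ᶻ ℚ.+-*-commutativeRing (+ n))
  LeadingTerm-# zero    = leading refl zero
  LeadingTerm-# (suc n) = LeadingTerm-+ (leading (refl {1#}) (const {1ℚ})) (LeadingTerm-# n)

  leadingTerms : GradedRelation (RingAdditionLaw.operations R) (RingAdditionLaw.operations ℚ.+-*-commutativeRing) 0ℓ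
  leadingTerms = record
    { L     = λ w d → LeadingTerm (w ℕ.+ d)
    ; _⟨+⟩_ = LeadingTerm-+
    ; _⟨-⟩_ = λ s t → LeadingTerm-+ s (LeadingTerm-neg t)
    ; _⟨*⟩_ = λ {w} {d} {v} {e} {x} {y} {x′} {y′} s t →
        ≡.subst (λ n → LeadingTerm n (x * y) (x′ ℚ.* y′)) (interchange w d v e) (LeadingTerm-* s t)
    ; ⟨#⟩   = LeadingTerm-#
    }
    where open CommutativeSemigroupProperties ℕ.+-commutativeSemigroup using (interchange)

  private
    -- The degrees of `a`, `b`, `c` are 2, 3, 3, and `b` and `c` are monic. Only bc reaches degree
    -- 6.
    α-top : LeadingTerm 6 (EllipticCurve.α E) 0ℚ
    α-top = leading (ι-* a b) (from-yes (top? 6 (a P.* b) 0ℚ))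
    β-top : LeadingTerm 6 (EllipticCurve.β E) 1ℚ
    β-top = leading (ι-* b c) (from-yes (top? 6 (b P.* c) 1ℚ))
    γ-top : LeadingTerm 6 (EllipticCurve.γ E) 0ℚ
    γ-top = leading (ι-* a c) (from-yes (top? 6 (a P.* c) 0ℚ))

    e₁-top : LeadingTerm 6 e₁ ⟦ 1 ⟧
    e₁-top = LeadingTerm-+ (LeadingTerm-+ α-top β-top) γ-top

    e₂-top : LeadingTerm 12 e₂ 0ℚ
    e₂-top = LeadingTerm-+ (LeadingTerm-+ (LeadingTerm-* α-top β-top) (LeadingTerm-* β-top γ-top)) (LeadingTerm-* α-top γ-top)

    e₃-top : LeadingTerm 18 e₃ 0ℚ
    e₃-top = LeadingTerm-* (LeadingTerm-* α-top β-top) γ-top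

    LeadingTerm-assoc : ∀ w v d {x r} → LeadingTerm (w ℕ.+ v ℕ.+ d) x r → LeadingTerm (w ℕ.+ (v ℕ.+ d)) x r
    LeadingTerm-assoc w v d {x} {r} = ≡.subst (λ n → LeadingTerm n x r) (ℕ.+-assoc w v d)

  open NodalReduction.Reduce ℚ⟨k⟩ _#?_ E leadingTerms
    LeadingTerm-0 LeadingTerm-neg LeadingTerm-assoc e₁-top e₂-top e₃-top public

  Reduction-∞ : Reduction ∞ 1 1
  Reduction-∞ = record
    { coordinates = ∞ refl refl
    ; weight = 0
    ; X-top  = leading refl zero
    -- The Y-coordinate of ∞ is free; k⁹ has the required weight 9 and gives [0 : 1 : 0].
    ; Y-top  = leading {poly = k⁹} refl (from-yes (top? 9 k⁹ 1ℚ))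
    ; Z-top  = leading refl zero
    ; smooth = λ ()
    ; ratio  = ≡.refl
    }
    where
    k⁹ : Polynomial.ℚ[k]
    k⁹ = 0ℚ ∷ 0ℚ ∷ 0ℚ ∷ 0ℚ ∷ 0ℚ ∷ 0ℚ ∷ 0ℚ ∷ 0ℚ ∷ 0ℚ ∷ 1ℚ ∷ []

  open Rank E[ℚ⟨k⟩] using (_·_)
  open RawMonoidDefinitions (RawGroup.rawMonoid E[ℚ⟨k⟩]) using () renaming (_×_ to _×ᴺ_)

  Reduction-× : ∀ {P p q} → Reduction P p q → ∀ n → Reduction (n ×ᴺ P) (p ℕ.^ n) (q ℕ.^ n)
  Reduction-× r zero    = Reduction-∞
  Reduction-× r (suc n) = Reduction-+ r (Reduction-× r n)

  Reduction-· : ∀ {P p q} → Reduction P p q → ∀ z → Reduction (z · P) (power p q z) (power q p z)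
  Reduction-· r (+ n)    = Reduction-× r n
  Reduction-· r -[1+ n ] = Reduction-neg (Reduction-× r (suc n))

  -- Two explicit points and their reductions.

  private
    polynomial : List ℤ → Polynomial.ℚ[k]
    polynomial = map (ℚ._/ 1)

  -- Write P = (0 , abc), Q = (8k(k² - 4)² , …) and T = (-ab , 0) for points of the
  -- curve. Then G₁ = P + Q + T and G₂ = Q - P.
  module G₁ where
    X Y : Polynomial.ℚ[k]
    X = polynomial (+ 0 ∷ ℤ.- + 96 ∷ + 368 ∷ ℤ.- + 304 ∷ + 152 ∷ ℤ.- + 46 ∷ + 3 ∷ [])
    Y = polynomial (+ 0 ∷ + 1024 ∷ + 1280 ∷ ℤ.- + 4480 ∷ + 5184 ∷ ℤ.- + 4192 ∷ + 2288 ∷ ℤ.- + 712 ∷ + 108 ∷ ℤ.- + 6 ∷ [])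

    point : Point
    point = affine (ι X) (ι Y) (from-yes (ι Y * ι Y ℚ⟨k⟩.≟ f (ι X)))

    reduction : Reduction point 3 1
    reduction = record
      { coordinates = affine (*-identityʳ (ι X)) (*-identityʳ (ι Y))
      ; weight = 0
      -- The reduction is (3 , -6), with u = (-9)/(-3) = 3.
      ; X-top  = leading {poly = X} refl (from-yes (top? 6 X (+ 3 ℚ./ 1)))
      ; Y-top  = leading {poly = Y} refl (from-yes (top? 9 Y (ℤ.- + 6 ℚ./ 1)))
      ; Z-top  = leading {poly = P.1#} refl const
      ; smooth = λ ()
      ; ratio  = ≡.refl
      }

  module G₂ where
    D X Y : Polynomial.ℚ[k]
    D = polynomial (ℤ.- + 4 ∷ + 2 ∷ [])
    X = polynomial (+ 1280 ∷ ℤ.- + 4096 ∷ + 9472 ∷ ℤ.- + 10240 ∷ + 9056 ∷ ℤ.- + 3328 ∷ + 1552 ∷ ℤ.- + 256 ∷ + 45 ∷ [])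
    Y = polynomial (ℤ.- + 20480 ∷ + 167936 ∷ ℤ.- + 479232 ∷ + 793600 ∷ ℤ.- + 1054976 ∷ + 940544 ∷ ℤ.- + 783360
          ∷ + 408448 ∷ ℤ.- + 212592 ∷ + 62160 ∷ ℤ.- + 17520 ∷ + 2412 ∷ ℤ.- + 315 ∷ [])

    x y : Carrier
    x = X ℚ⟨k⟩./ D P.* D ⟨ from-no (D P.* D Polynomial.≟ P.0#) ⟩
    y = Y ℚ⟨k⟩./ D P.* D P.* D ⟨ from-no (D P.* D P.* D Polynomial.≟ P.0#) ⟩

    point : Point
    point = affine x y (from-yes (y * y ℚ⟨k⟩.≟ f x))

    reduction : Reduction point 9 5
    reduction = record
      { coordinates = affine (from-yes (x * ι (D P.* D P.* D) ℚ⟨k⟩.≟ ι (X P.* D))) (from-yes (y * ι (D P.* D P.* D) ℚ⟨k⟩.≟ ι Y))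
      -- The coordinates are scaled by D³, of degree 3. The reduction is [90 : -315 : 8], with u =
      -- (-405)/(-225) = 9/5.
      ; weight = 3
      ; X-top  = leading {poly = X P.* D} refl (from-yes (top? 9 (X P.* D) (+ 90 ℚ./ 1)))
      ; Y-top  = leading {poly = Y} refl (from-yes (top? 12 Y (ℤ.- + 315 ℚ./ 1)))
      ; Z-top  = leading {poly = D P.* D P.* D} refl (from-yes (top? 3 (D P.* D P.* D) (+ 8 ℚ./ 1)))
      ; smooth = λ ()
      ; ratio  = ≡.refl
      }

-- Linear independence of the two points.

theorem4p2 : Rank.rank≥ E[ℚ⟨k⟩] 2
theorem4p2 = g , independent
  where
  open Infinity
  open Rank E[ℚ⟨k⟩]

  g : Fin 2 → RawGroup.Carrier E[ℚ⟨k⟩]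
  g zero       = G₁.point
  g (suc zero) = G₂.point

  independent : LinearlyIndependent g
  independent n e = λ { zero → proj₁ n≡0 ; (suc zero) → proj₂ n≡0 }
    where
    n≡0 : n zero ≡ +0 × n (suc zero) ≡ +0
    -- `sum` ends in a summand ∞, whose reduction 1/1 accounts for the trailing factors 1.
    n≡0 = 3-and-9/5-independent (n zero) (n (suc zero)) (Reduction-∞-unique (Reduction-resp e
      (Reduction-+ (Reduction-· G₁.reduction (n zero))
        (Reduction-+ (Reduction-· G₂.reduction (n (suc zero))) Reduction-∞))))
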